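{- Let $w\in W_0$ and equip $\Sigma$ with the Weyl chamber orientation $\phi_w$. Let $\lambda\in R^\vee$, $v\in W_0$, and let $\gamma$ be a gallery from $\mathbf{c}_\mathbf{f}$ to $t^\lambda v\,\mathbf{c}_\mathbf{f}$. Let $(\alpha_1,\dots,\alpha_n)$ be a $\phi_w$-positive folding pattern that can be applied to $\gamma$. Consider the path in the undirected moment graph $\mathcal{G}^{un}_{W_0}$ starting in the vertex $v$ with label sequence $(\alpha_1,\dots,\alpha_n)$. Then the end vertex of this path equals the spherical direction $\zeta(z)$ of the end alcove $z\mathbf{c}_\mathbf{f}$ of every gallery $\gamma'$ obtained from $\gamma$ by folding it with the folding pattern $(\alpha_1,\dots,\alpha_n)$.
   Context: Let $\Phi$ be an irreducible crystallographic root system in a Euclidean space $V$ with positive roots $\Phi^+$ and coroot lattice $R^\vee$, Weyl group $W_0$, and for $\alpha\in\Phi^+$ let $r_\alpha\in W_0$ be the reflection in $H_{\alpha,0}$. The affine Weyl group is $W=T\rtimes W_0$ with $T\cong R^\vee$ acting by translations; each $z\in W$ is uniquely $z=t^\mu u$ ($\mu\in R^\vee$, $u\in W_0$) and $\zeta(z):=u$ is its spherical direction. The walls of its Coxeter complex $\Sigma$ are $H_{\alpha,k}=\{y\in V:\langle y,\alpha\rangle=k\}$, $\alpha\in\Phi^+$, $k\in\mathbb{Z}$; $\alpha$ is the class of $H_{\alpha,k}$. Alcoves are closures of components of the complement of all walls; $\mathbf{c}_\mathbf{f}=\{y:0\le\langle y,\alpha\rangle\le1\ \forall\alpha\in\Phi^+\}$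 and $z\mapsto z\mathbf{c}_\mathbf{f}$ is a bijection $W\to$ alcoves. Panels are codimension-one faces of alcoves; panel $p$ lies in a unique wall $H_p$. $\mathcal{C}_u=u\{y:\langle y,\alpha\rangle\ge0\ \forall\alpha\in\Phi^+\}$. Weyl chamber orientation $\phi_w$: the positive side of $H_{\alpha,k}$ is $\{\langle y,\alpha\rangle\ge k\}$ if $\langle\cdot,\alpha\rangle\ge0$ on $\mathcal{C}_w$, else $\{\langle y,\alpha\rangle\le k\}$; $\phi_w(p,\mathbf{c})=+1$ iff alcove $\mathbf{c}$ lies on the positive side of $H_p$. A gallery is $\gamma=(\mathbf{c}_0,p_1,\mathbf{c}_1,\dots,p_n,\mathbf{c}_n)$ with alcoves $\mathbf{c}_i$ and panels $p_i\subseteq\mathbf{c}_{i-1}\cap\mathbf{c}_i$ (repetitions allowed). It is folded at $p_i$ if $\mathbf{c}_{i-1}=\mathbf{c}_i$, positively if moreover $\phi_w(p_i,\mathbf{c}_i)=+1$. Folding $\gamma$ at $p_i$ replaces it by $\gamma^i=(\mathbf{c}_0,p_1,\dots,\mathbf{c}_{i-1},p_i,r_i\mathbf{c}_i,r_ip_{i+1},\dots,r_ip_n,r_i\mathbf{c}_n)$, $r_i$ the affine reflection in $H_{p_i}$. "$\gamma'$ is obtained from $\gamma$ by folding it with the folding pattern $(\alpha_1,\dots,\alpha_n)$" means $\gamma'$ arises from $\gamma$ by folding at panels of indices $i_1<\dots<i_n$ such that, in $\gamma'$, the wall containing the $i_k$-th panel has class $\alpha_k$; the pattern is $\phi_w$-positive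 if these folds are all $\phi_w$-positive, and it "can be applied to $\gamma$" if such a $\gamma'$ with all these folds $\phi_w$-positive exists. The undirected moment graph $\mathcal{G}^{un}_{W_0}$ has vertex set $W_0$ and, for each $u\in W_0$ and $\alpha\in\Phi^+$, an undirected edge $\{u,r_\alpha u\}$ labeled $\alpha$ (so each vertex has exactly one incident edge with each label, and a path is determined by its start vertex and label sequence).
   Formalization: The Euclidean space V is replaced by a rational vector space with a rational-valued positive-definite inner product, so root systems, walls and alcoves are considered with rational points only. -}

module Defs where

open import Data.Nat using (ℕ; zero; suc) renaming (_<_ to _<ℕ_)
open import Data.Integer using (ℤ)
open import Data.Rational using (ℚ; 0ℚ; 1ℚ; _+_; _*_; _-_; -_; _≤_; _<_; _/_)
open import Data.Vec using (Vec; zipWith; replicate; map)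
open import Data.List using (List; []; _∷_; length; foldr)
import Data.List as L
open import Data.List.Membership.Propositional using (_∈_)
open import Data.List.Relation.Unary.All using (All)
open import Data.List.Relation.Unary.Linked using (Linked)
open import Data.List.Relation.Binary.Pointwise using (Pointwise)
open import Data.Maybe using (Maybe; just; nothing)
open import Data.Product using (Σ; ∃; ∃-syntax; _×_; _,_; proj₁; proj₂)
open import Data.Sum using (_⊎_)
open import Data.Unit using (⊤)
open import Relation.Nullary using (¬_)
open import Relation.Binary.PropositionalEquality using (_≡_; _≢_)

-- Rational vector space  ℚ^d  (the rational form of the Euclidean space V)

Vect : ℕ → Set
Vect d = Vec ℚ d

module _ {d : ℕ} where
  _+ᵥ_ : Vect d → Vect d → Vect d
  _+ᵥ_ = zipWith _+_

  _-ᵥ_ : Vect d → Vect d → Vect d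
  _-ᵥ_ = zipWith _-_

  _·ᵥ_ : ℚ → Vect d → Vect d
  c ·ᵥ x = map (c *_) x

  0ᵥ : Vect d
  0ᵥ = replicate d 0ℚ

  -ᵥ_ : Vect d → Vect d
  -ᵥ x = map -_ x

  lincomb : List (ℚ × Vect d) → Vect d
  lincomb = foldr (λ p acc → (proj₁ p ·ᵥ proj₂ p) +ᵥ acc) 0ᵥ

2ℚ : ℚ
2ℚ = 1ℚ + 1ℚ

fromℤ : ℤ → ℚ
fromℤ k = k / 1

IsInt : ℚ → Set
IsInt q = ∃[ k ] q ≡ fromℤ k

record RootSystem : Set₁ where
  field
    d    : ℕ
    ip   : Vect d → Vect d → ℚ
    ip-sym   : ∀ x y → ip x y ≡ ip y x
    ip-addˡ  : ∀ x y z → ip (x +ᵥ y) z ≡ ip x z + ip y z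
    ip-scalˡ : ∀ c x z → ip (c ·ᵥ x) z ≡ c * ip x z
    ip-pos   : ∀ x → x ≢ 0ᵥ → 0ℚ < ip x x
    Φ    : List (Vect d)
    Φ-nonempty : Φ ≢ []
    Φ-nonzero  : ¬ (0ᵥ ∈ Φ)
    Φ-spans    : ∀ x → ∃[ cs ] (All (λ p → proj₂ p ∈ Φ) cs × x ≡ lincomb cs)
    cor     : Vect d → Vect d
    cor-def : ∀ α → α ∈ Φ → ip α α ·ᵥ cor α ≡ 2ℚ ·ᵥ α
    Φ-refl  : ∀ α β → α ∈ Φ → β ∈ Φ → (β -ᵥ (ip β α ·ᵥ cor α)) ∈ Φ
    Φ-cryst : ∀ α β → α ∈ Φ → β ∈ Φ → IsInt (ip β (cor α))
    Φ-reduced : ∀ α c → α ∈ Φ → (c ·ᵥ α) ∈ Φ → c ≡ 1ℚ ⊎ c ≡ - 1ℚ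
    Φ-irred : ∀ (P : Vect d → Set) →
              (∀ α β → α ∈ Φ → β ∈ Φ → P α → ¬ P β → ip α β ≡ 0ℚ) →
              ¬ ((∃[ α ] (α ∈ Φ × P α)) × (∃[ β ] (β ∈ Φ × ¬ P β)))
    Φ⁺ : List (Vect d)
    Φ⁺-positive : ∃[ ξ ] ((∀ α → α ∈ Φ → ip ξ α ≢ 0ℚ) ×
                          (∀ α → (α ∈ Φ⁺ → α ∈ Φ × 0ℚ < ip ξ α) ×
                                 (α ∈ Φ × 0ℚ < ip ξ α → α ∈ Φ⁺)))

module RS (R : RootSystem) where
  open RootSystem R public

  V : Set
  V = Vect d

  refl : V → V → V
  refl α y = y -ᵥ (ip y α ·ᵥ cor α)

  InCorootLattice : V → Set
  InCorootLattice μ = ∃[ cs ] (All (λ p → proj₂ p ∈ Φ) cs ×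
                       μ ≡ L.foldr (λ (p : ℤ × V) acc → (fromℤ (proj₁ p) ·ᵥ cor (proj₂ p)) +ᵥ acc) 0ᵥ cs)

  -- Weyl group W₀: words in reflections (r_{a₁} r_{a₂} ⋯ r_{aₘ}),
  -- two words being the same element iff they act identically.
  record W0 : Set where
    constructor mkW0
    field word : List V
  open W0 public

  lin : W0 → V → V
  lin u y = foldr refl y (word u)

  IsW0 : W0 → Set
  IsW0 u = All (_∈ Φ⁺) (word u)

  _≈₀_ : W0 → W0 → Set
  u ≈₀ u' = ∀ y → lin u y ≡ lin u' y

  1W0 : W0
  1W0 = mkW0 []

  rW0 : V → W0 → W0
  rW0 α u = mkW0 (α ∷ word u)

  record Waff : Set where
    constructor _⋉_
    field
      trans : V
      dir   : W0
  open Waff public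

  act : Waff → V → V
  act z y = trans z +ᵥ lin (dir z) y

  InW : Waff → Set
  InW z = InCorootLattice (trans z) × IsW0 (dir z)

  ζ : Waff → W0
  ζ = dir

  t^_·_ : V → W0 → Waff
  t^ μ · v = μ ⋉ v

  -- Alcoves:  c_f  and  z c_f  (alcoves are represented through z ↦ z c_f)
  InCf : V → Set
  InCf y = ∀ α → α ∈ Φ⁺ → (0ℚ ≤ ip y α) × (ip y α ≤ 1ℚ)

  InAlc : Waff → V → Set
  InAlc z x = ∃[ y ] (InCf y × x ≡ act z y)

  idW : Waff
  idW = 0ᵥ ⋉ 1W0

  AlcEq : Waff → Waff → Set
  AlcEq z z' = ∀ x → (InAlc z x → InAlc z' x) × (InAlc z' x → InAlc z x)

  record Wall : Set where
    constructor H[_,_]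
    field
      root  : V
      level : ℚ
  open Wall public

  OnWall : Wall → V → Set
  OnWall H y = ip y (root H) ≡ level H

  IsWall : Wall → Set
  IsWall H = root H ∈ Φ × IsInt (level H)

  ClassLevel : Wall → V → ℚ → Set
  ClassLevel H α k = α ∈ Φ⁺ × IsInt k ×
                     (∀ y → (OnWall H y → ip y α ≡ k) × (ip y α ≡ k → OnWall H y))

  HasClass : Wall → V → Set
  HasClass H α = ∃[ k ] ClassLevel H α k

  aref : Wall → V → V
  aref H y = y -ᵥ ((ip y (root H) - level H) ·ᵥ cor (root H))

  -- r_H (z c_f) = (r_H z) c_f ,  r_H ∘ t^μ u = t^{r_H μ} (r_β u)
  reflAlc : Wall → Waff → Waff
  reflAlc H z = aref H (trans z) ⋉ rW0 (root H) (dir z)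

  reflWall : Wall → Wall → Wall
  reflWall H H' = H[ refl (root H) (root H') ,
                     level H' - level H * ip (root H') (cor (root H)) ]

  -- Panels: the panel of alcove c in the wall H is c ∩ H, required to be a
  -- codimension-one face, i.e. to contain d affinely independent points.
  LinIndep : List V → Set
  LinIndep vs = ∀ (cs : List ℚ) → length cs ≡ length vs →
                lincomb (L.zip cs vs) ≡ 0ᵥ → All (_≡ 0ℚ) cs

  AffIndep : List V → Set
  AffIndep []       = ⊤
  AffIndep (p ∷ qs) = LinIndep (L.map (λ q → q -ᵥ p) qs)

  IsPanel : Waff → Wall → Set
  IsPanel c H = ∃[ ps ] (length ps ≡ d ×
                         All (λ x → InAlc c x × OnWall H x) ps × AffIndep ps)

  -- Galleries  (c₀, p₁, c₁, …, pₙ, cₙ); step i (0-based) stores the wall H_{p_{i+1}}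
  -- and the alcove c_{i+1}; the panel p_{i+1} is c_i ∩ H_{p_{i+1}}.
  record Step : Set where
    constructor step
    field
      wall : Wall
      alc  : Waff
  open Step public

  record Gallery : Set where
    constructor gallery
    field
      start : Waff
      steps : List Step
  open Gallery public

  ValidSteps : Waff → List Step → Set
  ValidSteps prev []       = ⊤
  ValidSteps prev (s ∷ ss) =
    IsWall (wall s) × InW (alc s) × IsPanel prev (wall s) ×
    (∀ x → InAlc prev x → OnWall (wall s) x → InAlc (alc s) x) ×
    ValidSteps (alc s) ss

  IsGallery : Gallery → Set
  IsGallery γ = InW (start γ) × ValidSteps (start γ) (steps γ)

  endAlc : Gallery → Waff
  endAlc γ = L.foldl (λ _ s → alc s) (start γ) (steps γ)

  nth : {A : Set} → List A → ℕ → Maybe A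
  nth []       _       = nothing
  nth (x ∷ xs) zero    = just x
  nth (x ∷ xs) (suc i) = nth xs i

  alcAt : Gallery → ℕ → Maybe Waff
  alcAt γ zero    = just (start γ)
  alcAt γ (suc j) = Data.Maybe.map alc (nth (steps γ) j)

  -- Folding at (0-based) step i, i.e. at panel p_{i+1}
  reflStep : Wall → Step → Step
  reflStep H s = step (reflWall H (wall s)) (reflAlc H (alc s))

  foldSteps : ℕ → List Step → List Step
  foldSteps i       []       = []
  foldSteps zero    (s ∷ ss) = step (wall s) (reflAlc (wall s) (alc s)) ∷ L.map (reflStep (wall s)) ss
  foldSteps (suc i) (s ∷ ss) = s ∷ foldSteps i ss

  foldAt : ℕ → Gallery → Gallery
  foldAt i γ = gallery (start γ) (foldSteps i (steps γ))

  foldAll : List ℕ → Gallery → Gallery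
  foldAll []       γ = γ
  foldAll (i ∷ is) γ = foldAll is (foldAt i γ)

  HasClassAt : Gallery → ℕ → V → Set
  HasClassAt γ i α = ∃[ s ] (nth (steps γ) i ≡ just s × HasClass (wall s) α)

  FoldData : Gallery → List V → List ℕ → Gallery → Set
  FoldData γ pat ixs γ' =
    Linked _<ℕ_ ixs × All (_<ℕ length (steps γ)) ixs ×
    γ' ≡ foldAll ixs γ × Pointwise (HasClassAt γ') ixs pat

  ObtainedByFolding : Gallery → List V → Gallery → Set
  ObtainedByFolding γ pat γ' = ∃[ ixs ] FoldData γ pat ixs γ'

  InC : V → Set
  InC y = ∀ β → β ∈ Φ⁺ → 0ℚ ≤ ip y β

  NonnegOnCw : W0 → V → Set
  NonnegOnCw w α = ∀ y → InC y → 0ℚ ≤ ip (lin w y) α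

  -- φ_w(p, c) = +1 : alcove c lies on the positive side of H_p
  PosSide : W0 → Wall → Waff → Set
  PosSide w H c = ∃[ α ] ∃[ k ] (ClassLevel H α k ×
    (NonnegOnCw w α → ∀ x → InAlc c x → k ≤ ip x α) ×
    (¬ NonnegOnCw w α → ∀ x → InAlc c x → ip x α ≤ k))

  PosFoldAt : W0 → Gallery → ℕ → Set
  PosFoldAt w γ i = ∃[ s ] ∃[ c ] (nth (steps γ) i ≡ just s × alcAt γ i ≡ just c ×
                                   AlcEq c (alc s) × PosSide w (wall s) (alc s))

  CanApply : W0 → Gallery → List V → Set
  CanApply w γ pat = ∃[ γ' ] ∃[ ixs ] (FoldData γ pat ixs γ' × All (PosFoldAt w γ') ixs)

  -- Undirected moment graph G^un_{W₀}: edge {u, r_α u} labelled α.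
  -- End vertex of the path from u with label sequence (α₁,…,αₙ).
  edge : W0 → V → W0
  edge u α = rW0 α u

  pathEnd : W0 → List V → W0
  pathEnd u []       = u
  pathEnd u (α ∷ αs) = pathEnd (edge u α) αs

{-# OPTIONS --safe #-}

-- Folding at the i-th panel composes the end alcove with the reflection in the wall of that panel, and
-- this wall is not changed by the later folds; so the direction of the end alcove of γ' is the product of
-- the reflections r_{αₖ} applied to the direction of the end alcove of γ, which is the path of the moment graph.
--
-- What remains is that z c_f determines the direction of z, and this follows once c_f is known to meet
-- every orbit of W at most once. Fix a generic x in c_f and rewrite a point y to s_H y whenever the
-- wall H separates y from x. This brings y closer to x, and it terminates because the distances to x
-- are discrete along an orbit; the points of c_f are normal forms. If H and H' both
-- separate y from x, then s_H' s_H y or s_H s_H' y is closer to x than y and is a reflection of both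
-- s_H y and s_H' y. By Newman's lemma normal forms in an orbit are unique.

module Submission where

open import Defs
open import Data.Empty using (⊥-elim)
open import Data.Integer using (ℤ; +_; -[1+_])
import Data.Integer as ℤ
import Data.Integer.Properties as ℤ
open import Data.List using (List; []; _∷_; _++_; length)
import Data.List as List
open import Data.List.Membership.Propositional using (_∈_)
open import Data.List.Properties using (length-map)
open import Data.List.Relation.Binary.Pointwise using (Pointwise; []; _∷_)
open import Data.List.Relation.Unary.All using (All; []; _∷_)
import Data.List.Relation.Unary.All as All
import Data.List.Relation.Unary.All.Properties as All
open import Data.List.Relation.Unary.AllPairs using (AllPairs; []; _∷_)
open import Data.List.Relation.Unary.Linked.Properties using (Linked⇒AllPairs)
open import Data.Maybe using (just)
open import Data.Maybe.Properties using (just-injective)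
open import Data.Nat using (ℕ; zero; suc) renaming (_<_ to _<ℕ_)
import Data.Nat as ℕ
import Data.Nat.Coprimality as Coprimality
import Data.Nat.Properties as ℕ
open import Data.Product using (∃; ∃-syntax; _×_; _,_; proj₁; proj₂)
open import Data.Rational
open import Data.Rational.Properties
import Data.Rational.Unnormalised as ℚᵘ
open import Data.Sum using (_⊎_; inj₁; inj₂; [_,_]′)
open import Data.Vec using ([]; _∷_; head; tail)
open import Data.Vec.Properties using (≡-dec)
open import Function using (_∘_)
open import Induction.WellFounded using (WellFounded; Acc; acc)
open import Relation.Binary using (tri<; tri≈; tri>)
open import Relation.Binary.Construct.Closure.ReflexiveTransitive using (Star; ε; _◅_; _◅◅_; reverse)
open import Relation.Binary.PropositionalEquality
open import Relation.Nullary using (¬_; Dec; yes; no)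
open import Relation.Nullary.Decidable using (dec⇒maybe; decidable-stable; from-yes)
open import Tactic.RingSolver using (solve-∀)
open import Tactic.RingSolver.Core.AlmostCommutativeRing using (AlmostCommutativeRing; fromCommutativeRing)

-- Signs and cancellation in the ordered field ℚ

ℚ-ring : AlmostCommutativeRing _ _
ℚ-ring = fromCommutativeRing +-*-commutativeRing λ q → dec⇒maybe (0ℚ ≟ q)

pos*pos>0 : ∀ {a b} → 0ℚ < a → 0ℚ < b → 0ℚ < a * b
pos*pos>0 {a} {b} a>0 b>0 = positive⁻¹ _ {{pos*pos⇒pos a {{positive a>0}} b {{positive b>0}}}}

neg*neg>0 : ∀ {a b} → a < 0ℚ → b < 0ℚ → 0ℚ < a * b
neg*neg>0 {a} {b} a<0 b<0 = positive⁻¹ _ {{neg*neg⇒pos a {{negative a<0}} b {{negative b<0}}}}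

neg*pos<0 : ∀ {a b} → a < 0ℚ → 0ℚ < b → a * b < 0ℚ
neg*pos<0 {a} {b} a<0 b>0 = negative⁻¹ _ {{neg*pos⇒neg a {{negative a<0}} b {{positive b>0}}}}

pos*neg<0 : ∀ {a b} → 0ℚ < a → b < 0ℚ → a * b < 0ℚ
pos*neg<0 {a} {b} a>0 b<0 = negative⁻¹ _ {{pos*neg⇒neg a {{positive a>0}} b {{negative b<0}}}}

nonNeg*nonNeg≥0 : ∀ {a b} → 0ℚ ≤ a → 0ℚ ≤ b → 0ℚ ≤ a * b
nonNeg*nonNeg≥0 {a} {b} a≥0 b≥0 =
  nonNegative⁻¹ _ {{nonNeg*nonNeg⇒nonNeg a {{nonNegative a≥0}} b {{nonNegative b≥0}}}}

nonPos*nonPos≥0 : ∀ {a b} → a ≤ 0ℚ → b ≤ 0ℚ → 0ℚ ≤ a * b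
nonPos*nonPos≥0 {a} {b} a≤0 b≤0 =
  nonNegative⁻¹ _ {{nonPos*nonPos⇒nonPos a {{nonPositive a≤0}} b {{nonPositive b≤0}}}}

square>0 : ∀ p → p ≢ 0ℚ → 0ℚ < p * p
square>0 p p≢0 with <-cmp p 0ℚ
... | tri< p<0 _ _ = neg*neg>0 p<0 p<0
... | tri≈ _ p≡0 _ = ⊥-elim (p≢0 p≡0)
... | tri> _ _ p>0 = pos*pos>0 p>0 p>0

*-cancelˡ-pos : ∀ {c a b} → 0ℚ < c → c * a ≡ c * b → a ≡ b
*-cancelˡ-pos {c} c>0 eq = ≤-antisym
  (*-cancelˡ-≤-pos c {{positive c>0}} (≤-reflexive eq))
  (*-cancelˡ-≤-pos c {{positive c>0}} (≤-reflexive (sym eq)))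

-- A second multiplication by `p` replaces it by the positive `p * p`, which can be cancelled
-- whatever the sign of `p`.
zero-factor : ∀ {p h} → p ≢ 0ℚ → p * h ≡ 0ℚ → h ≡ 0ℚ
zero-factor {p} {h} p≢0 ph≡0 = *-cancelˡ-pos (square>0 p p≢0) (begin
  p * p * h    ≡⟨ *-assoc p p h ⟩
  p * (p * h)  ≡⟨ cong (p *_) ph≡0 ⟩
  p * 0ℚ       ≡⟨ *-zeroʳ p ⟩
  0ℚ           ≡⟨ *-zeroʳ (p * p) ⟨
  p * p * 0ℚ   ∎)
  where open ≡-Reasoning

≤⇒0≤- : ∀ {a b} → a ≤ b → 0ℚ ≤ b - a
≤⇒0≤- {a} {b} a≤b = subst (_≤ b - a) (+-inverseʳ a) (+-monoˡ-≤ (- a) a≤b)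

≤⇒-≤0 : ∀ {a b} → a ≤ b → a - b ≤ 0ℚ
≤⇒-≤0 {a} {b} a≤b = subst (a - b ≤_) (+-inverseʳ b) (+-monoˡ-≤ (- b) a≤b)

<⇒0<- : ∀ {a b} → a < b → 0ℚ < b - a
<⇒0<- {a} {b} a<b = subst (_< b - a) (+-inverseʳ a) (+-monoˡ-< (- a) a<b)

<⇒-<0 : ∀ {a b} → a < b → a - b < 0ℚ
<⇒-<0 {a} {b} a<b = subst (a - b <_) (+-inverseʳ b) (+-monoˡ-< (- b) a<b)

inverse : ∀ {q} → 0ℚ < q → ∃[ a ] (0ℚ < a × a * q ≡ 1ℚ)
inverse {q} q>0 = (1/ q) , positive⁻¹ _ {{1/pos⇒pos q}} , *-inverseˡ q
  where instance
    q-pos = positive q>0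
    q-nonZero = pos⇒nonZero q

-- Integers inside ℚ

-- The quotient `k / 1` is reduced to lowest terms, a computation that is stuck for a variable `k`.
-- From the explicit normal form, sums, products and comparisons in ℚ unfold to those of ℤ.
fromℤ-mkℚ : ∀ k → fromℤ k ≡ mkℚ k 0 (Coprimality.sym (Coprimality.1-coprimeTo ℤ.∣ k ∣))
fromℤ-mkℚ (+ n)     = normalize-coprime (Coprimality.sym (Coprimality.1-coprimeTo n))
fromℤ-mkℚ (-[1+ n ]) = cong -_ (normalize-coprime (Coprimality.sym (Coprimality.1-coprimeTo (suc n))))

fromℤ-+ : ∀ i j → fromℤ (i ℤ.+ j) ≡ fromℤ i + fromℤ j
fromℤ-+ i j rewrite fromℤ-mkℚ i | fromℤ-mkℚ j =
  cong₂ (λ k l → fromℤ (k ℤ.+ l)) (sym (ℤ.*-identityʳ i)) (sym (ℤ.*-identityʳ j))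

fromℤ-* : ∀ i j → fromℤ (i ℤ.* j) ≡ fromℤ i * fromℤ j
fromℤ-* i j rewrite fromℤ-mkℚ i | fromℤ-mkℚ j = refl

fromℤ-neg : ∀ i → fromℤ (ℤ.- i) ≡ - fromℤ i
fromℤ-neg i = trans (cong fromℤ (sym (ℤ.-1*i≡-i i)))
  (trans (fromℤ-* (ℤ.- (+ 1)) i) (sym (trans (cong -_ (sym (*-identityˡ (fromℤ i)))) (neg-distribˡ-* 1ℚ (fromℤ i)))))

fromℤ-mono-≤ : ∀ {i j} → i ℤ.≤ j → fromℤ i ≤ fromℤ j
fromℤ-mono-≤ {i} {j} i≤j rewrite fromℤ-mkℚ i | fromℤ-mkℚ j = *≤* (ℤ.*-monoʳ-≤-nonNeg (+ 1) i≤j)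

fromℤ-mono-< : ∀ {i j} → i ℤ.< j → fromℤ i < fromℤ j
fromℤ-mono-< {i} {j} i<j rewrite fromℤ-mkℚ i | fromℤ-mkℚ j = *<* (ℤ.*-monoʳ-<-pos (+ 1) i<j)

fromℤ-cancel-< : ∀ {i j} → fromℤ i < fromℤ j → i ℤ.< j
fromℤ-cancel-< {i} {j} lt rewrite fromℤ-mkℚ i | fromℤ-mkℚ j = ℤ.*-cancelʳ-<-nonNeg (+ 1) (drop-*<* lt)

i<1+∣i∣ : ∀ i → i ℤ.< + suc ℤ.∣ i ∣
i<1+∣i∣ (+ n)     = ℤ.+<+ ℕ.≤-refl
i<1+∣i∣ (-[1+ n ]) = ℤ.-<+

int-+ : ∀ {a b} → IsInt a → IsInt b → IsInt (a + b)
int-+ (i , refl) (j , refl) = i ℤ.+ j , sym (fromℤ-+ i j)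

int-* : ∀ {a b} → IsInt a → IsInt b → IsInt (a * b)
int-* (i , refl) (j , refl) = i ℤ.* j , sym (fromℤ-* i j)

int-neg : ∀ {a} → IsInt a → IsInt (- a)
int-neg (i , refl) = ℤ.- i , sym (fromℤ-neg i)

int-- : ∀ {a b} → IsInt a → IsInt b → IsInt (a - b)
int-- a b = int-+ a (int-neg b)

int-0 : IsInt 0ℚ
int-0 = + 0 , refl

denominator*q : ∀ q → fromℤ (↧ q) * q ≡ fromℤ (↥ q)
denominator*q q@(mkℚ n d _) rewrite fromℤ-mkℚ (↧ q) =
  -- The product unfolds to a quotient with denominator `1 ℕ.* suc d`, that is `suc (d ℕ.+ 0)`. It
  -- is compared with `n / 1` before either is reduced to lowest terms.
  fromℚᵘ-cong {ℚᵘ.mkℚᵘ (+ suc d ℤ.* n) (d ℕ.+ 0)} {ℚᵘ.mkℚᵘ n 0} (ℚᵘ.*≡* (begin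
    + suc d ℤ.* n ℤ.* + 1  ≡⟨ ℤ.*-identityʳ _ ⟩
    + suc d ℤ.* n          ≡⟨ ℤ.*-comm (+ suc d) n ⟩
    n ℤ.* + suc d          ≡⟨ cong (λ m → n ℤ.* + suc m) (sym (ℕ.+-identityʳ d)) ⟩
    n ℤ.* + suc (d ℕ.+ 0)  ∎))
  where open ≡-Reasoning

-- The product of the denominators serves. Its integrality is kept because it will also multiply
-- levels of walls and numbers that are already cleared.
common-denominator : (qs : List ℚ) → ∃[ N ] (0ℚ < N × IsInt N × All (λ q → IsInt (N * q)) qs)
common-denominator [] = 1ℚ , positive⁻¹ 1ℚ , (+ 1 , refl) , []
common-denominator (q ∷ qs) with common-denominator qs
... | N , N>0 , N-int , Nqs = δ * N , pos*pos>0 δ>0 N>0 , int-* δ-int N-int ,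
      subst IsInt (swap δ N q) (int-* N-int (↥ q , denominator*q q)) ∷
      All.map (λ {r} Nr → subst IsInt (sym (*-assoc δ N r)) (int-* δ-int Nr)) Nqs
  where
  δ = fromℤ (↧ q)
  δ-int : IsInt δ
  δ-int = ↧ q , refl
  δ>0 : 0ℚ < δ
  δ>0 = fromℤ-mono-< {+ 0} {↧ q} (ℤ.+<+ (ℕ.s≤s ℕ.z≤n))
  swap : ∀ δ N q → N * (δ * q) ≡ δ * N * q
  swap = solve-∀ ℚ-ring

-- The bound is asked on the whole interval from 0 to `δ`, so that finitely many such bounds are met
-- together by the least of their `δ`.
small-multiple : ∀ {b} c → 0ℚ < b → ∃[ δ ] (0ℚ < δ × (∀ t → 0ℚ ≤ t → t ≤ δ → t * c ≤ b))
small-multiple {b} c b>0 with ≤-total c 0ℚ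
... | inj₁ c≤0 = 1ℚ , positive⁻¹ 1ℚ , λ t t≥0 _ → ≤-trans
      (subst (t * c ≤_) (*-zeroʳ t) (*-monoˡ-≤-nonNeg t {{nonNegative t≥0}} c≤0)) (<⇒≤ b>0)
... | inj₂ c≥0 with <-cmp 0ℚ c
... | tri≈ _ refl _ = 1ℚ , positive⁻¹ 1ℚ , λ t _ _ → subst (_≤ b) (sym (*-zeroʳ t)) (<⇒≤ b>0)
... | tri> _ _ c<0 = ⊥-elim (<-irrefl refl (<-≤-trans c<0 c≥0))
... | tri< c>0 _ _ with inverse c>0
-- For positive `c` the threshold is the quotient of `b` by `c`; in the other cases 1 is an
-- arbitrary choice.
...   | i , i>0 , i*c≡1 = b * i , pos*pos>0 b>0 i>0 , λ t _ t≤ →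
        subst (t * c ≤_) (trans (*-assoc b i c) (trans (cong (b *_) i*c≡1) (*-identityʳ b)))
          (*-monoʳ-≤-nonNeg c {{nonNegative c≥0}} t≤)

small-multiples : (bs : List (ℚ × ℚ)) → All (λ bc → 0ℚ < proj₁ bc) bs →
  ∃[ δ ] (0ℚ < δ × (∀ t → 0ℚ ≤ t → t ≤ δ → All (λ bc → t * proj₂ bc ≤ proj₁ bc) bs))
small-multiples [] [] = 1ℚ , positive⁻¹ 1ℚ , λ _ _ _ → []
small-multiples ((b , c) ∷ bs) (b>0 ∷ bs>0) with small-multiple c b>0 | small-multiples bs bs>0
... | δ , δ>0 , small | δ' , δ'>0 , smalls with ≤-total δ δ'
...   | inj₁ δ≤δ' = δ , δ>0 , λ t t≥0 t≤ → small t t≥0 t≤ ∷ smalls t t≥0 (≤-trans t≤ δ≤δ')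
...   | inj₂ δ'≤δ = δ' , δ'>0 , λ t t≥0 t≤ → small t t≥0 (≤-trans t≤ δ'≤δ) ∷ smalls t t≥0 t≤

-- An integer is at most 0 or at least 1. The weak and the strict inequality come from the same
-- case, which later puts the closed alcove and its interior on the same side of a wall.
unit-interval-side : ∀ k → IsInt k →
  ((∀ t → 0ℚ ≤ t → 0ℚ ≤ t - k) × (∀ t → 0ℚ < t → 0ℚ < t - k)) ⊎
  ((∀ t → t ≤ 1ℚ → t - k ≤ 0ℚ) × (∀ t → t < 1ℚ → t - k < 0ℚ))
unit-interval-side .(fromℤ k) (k , refl) with k ℤ.≤? + 0
... | yes k≤0 = inj₁ ((λ t t≥0 → ≤⇒0≤- (≤-trans (fromℤ-mono-≤ {k} {+ 0} k≤0) t≥0)) ,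
                       (λ t t>0 → <⇒0<- (≤-<-trans (fromℤ-mono-≤ {k} {+ 0} k≤0) t>0)))
... | no k≰0 = inj₂ ((λ t t≤1 → ≤⇒-≤0 (≤-trans t≤1 1≤k)) , (λ t t<1 → <⇒-<0 (<-≤-trans t<1 1≤k)))
  where
  1≤k : 1ℚ ≤ fromℤ k
  1≤k = fromℤ-mono-≤ {+ 1} {k} (ℤ.i<j⇒suc[i]≤j (ℤ.≰⇒> k≰0))

-- The inequality for two separating walls

neg-factor : ∀ {c A} → c < 0ℚ → 0ℚ < c * A → A < 0ℚ
neg-factor {c} {A} c<0 cA>0 =
  *-cancelˡ-<-nonPos c {{nonPositive (<⇒≤ c<0)}} (subst (_< c * A) (sym (*-zeroʳ c)) cA>0)

-- The last hypothesis compares the negative ratios `h' / p'` and `h / p`, with denominators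
-- cleared. Under it, `identity` writes the claimed quantity times the negative `p' * h' * (p * p)`
-- as a positive multiple of the quadratic form plus a nonnegative term.
rotation-closerˡ : ∀ a b e p h p' h' → 0ℚ < a → p * h < 0ℚ → p' * h' < 0ℚ →
  0ℚ < a * h * h + b * h' * h' - e * h * h' →
  p' * h' * (p * p) ≤ p * h * (p' * p') →
  a * p * h + b * p' * h' - e * p' * h < 0ℚ
rotation-closerˡ a b e p h p' h' a>0 s<0 s'<0 Q>0 le =
  neg-factor (neg*pos<0 s'<0 (p²>0 p h s<0)) (subst (0ℚ <_) (identity a b e p h p' h')
    (+-mono-<-≤ (pos*pos>0 Q>0 (pos*pos>0 (p²>0 p h s<0) (p²>0 p' h' s'<0)))
      (nonNeg*nonNeg≥0 (<⇒≤ (pos*pos>0 a>0 (neg-antimono-< s<0))) (≤⇒0≤- le))))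
  where
  p²>0 : ∀ p h → p * h < 0ℚ → 0ℚ < p * p
  p²>0 p h s<0 = square>0 p λ { refl → <-irrefl (*-zeroˡ h) s<0 }
  identity : ∀ a b e p h p' h' → (a * h * h + b * h' * h' - e * h * h') * (p * p * (p' * p')) +
        a * - (p * h) * (p * h * (p' * p') - p' * h' * (p * p)) ≡
        p' * h' * (p * p) * (a * p * h + b * p' * h' - e * p' * h)
  identity = solve-∀ ℚ-ring

-- The points y at height h, h' and x at height p, p' over two walls separating them: the rotation
-- by the product of the two reflections, or its inverse, moves y closer to x.
rotation-closer : ∀ a b e p h p' h' → 0ℚ < a → 0ℚ < b → p * h < 0ℚ → p' * h' < 0ℚ →
  0ℚ < a * h * h + b * h' * h' - e * h * h' →
  a * p * h + b * p' * h' - e * p' * h < 0ℚ ⊎ b * p' * h' + a * p * h - e * p * h' < 0ℚ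
rotation-closer a b e p h p' h' a>0 b>0 s<0 s'<0 Q>0
  with ≤-total (p' * h' * (p * p)) (p * h * (p' * p'))
... | inj₁ le = inj₁ (rotation-closerˡ a b e p h p' h' a>0 s<0 s'<0 Q>0 le)
... | inj₂ ge = inj₂ (rotation-closerˡ b a e p' h' p h b>0 s'<0 s<0 (subst (0ℚ <_) (swap a b e h h') Q>0) ge)
  where
  swap : ∀ a b e h h' → a * h * h + b * h' * h' - e * h * h' ≡ b * h' * h' + a * h * h - e * h' * h
  swap = solve-∀ ℚ-ring

-- Newman's lemma in the form that only asks each peak to be bridged by a zigzag lying below its top.
module Confluence {A : Set} (_⟶_ _≺_ : A → A → Set)
  (wf : WellFounded _≺_)
  (decreasing : ∀ {a b} → a ⟶ b → b ≺ a)
  (stable : ∀ (a b : A) → ¬ ¬ a ≡ b → a ≡ b)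
  where

  -- Equality counts as an edge because a reflection fixes the points of its own wall and is then no
  -- rewriting in either direction.
  Edge : A → A → Set
  Edge a b = a ⟶ b ⊎ b ⟶ a ⊎ a ≡ b

  module _ (peak : ∀ {a b c} → a ⟶ b → a ⟶ c → b ≡ c ⊎ ∃[ d ] (d ≺ a × Edge b d × Edge d c)) where

    Normal : A → Set
    Normal a = ∀ b → ¬ (a ⟶ b)

    _⇓_ : A → A → Set
    a ⇓ c = Star _⟶_ a c × Normal c

    -- Whether a point can be rewritten is not decided, so normal forms exist only up to ¬¬; this suffices
    -- because equality is stable.
    normalise : ∀ {a} → Acc _≺_ a → ¬ ¬ (∃[ c ] (a ⇓ c))
    normalise {a} (acc rec) none = none (a , ε , λ b a⟶b →
      normalise (rec (decreasing a⟶b)) λ (c , b⟶*c , normal) → none (c , a⟶b ◅ b⟶*c , normal))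

    mutual
      -- For different first steps, a normal form `e` of the bridging point `d` is compared with `c`
      -- along the edge from `b` to `d` and with `c'` along the edge from `d` to `b'`. The points
      -- `b`, `d` and `b'` all lie below `a`, so the recursion descends even where an edge goes up.
      ⇓-unique : ∀ {a c c'} → Acc _≺_ a → a ⇓ c → a ⇓ c' → c ≡ c'
      ⇓-unique _ (ε , _) (ε , _) = refl
      ⇓-unique _ (ε , normal) (a⟶b ◅ _ , _) = ⊥-elim (normal _ a⟶b)
      ⇓-unique _ (a⟶b ◅ _ , _) (ε , normal) = ⊥-elim (normal _ a⟶b)
      ⇓-unique (acc rec) (a⟶b ◅ b⟶* , normal) (a⟶b' ◅ b'⟶* , normal') with peak a⟶b a⟶b'
      ... | inj₁ refl = ⇓-unique (rec (decreasing a⟶b)) (b⟶* , normal) (b'⟶* , normal')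
      ... | inj₂ (d , d≺a , bd , db') = stable _ _ λ c≢c' → normalise (rec d≺a) λ (e , d⇓e) →
        c≢c' (trans (⇓-step (rec (decreasing a⟶b)) (rec d≺a) bd (b⟶* , normal) d⇓e)
                    (⇓-step (rec d≺a) (rec (decreasing a⟶b')) db' d⇓e (b'⟶* , normal')))

      -- The reduction from the lower end of the edge, preceded by the edge, is a second reduction
      -- from the upper end.
      ⇓-step : ∀ {a b c c'} → Acc _≺_ a → Acc _≺_ b → Edge a b → a ⇓ c → b ⇓ c' → c ≡ c'
      ⇓-step acc-a _ (inj₁ a⟶b) a⇓c (b⟶*c' , normal) = ⇓-unique acc-a a⇓c (a⟶b ◅ b⟶*c' , normal)
      ⇓-step _ acc-b (inj₂ (inj₁ b⟶a)) (a⟶*c , normal) b⇓c' = ⇓-unique acc-b (b⟶a ◅ a⟶*c , normal) b⇓c'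
      ⇓-step acc-a _ (inj₂ (inj₂ refl)) a⇓c b⇓c' = ⇓-unique acc-a a⇓c b⇓c'

    ⇓-convertible : ∀ {a c c'} → Star Edge a c' → Normal c' → a ⇓ c → c ≡ c'
    ⇓-convertible ε _ (ε , _) = refl
    ⇓-convertible ε normal (a⟶b ◅ _ , _) = ⊥-elim (normal _ a⟶b)
    ⇓-convertible (ab ◅ path) normal a⇓c = stable _ _ λ c≢c' → normalise (wf _) λ (e , b⇓e) →
      c≢c' (trans (⇓-step (wf _) (wf _) ab a⇓c b⇓e) (⇓-convertible path normal b⇓e))

    convertible-normal-unique : ∀ {c c'} → Star Edge c c' → Normal c → Normal c' → c ≡ c'
    convertible-normal-unique path normal normal' = ⇓-convertible path normal' (ε , normal)

-- Coordinate vectors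

-ᵥ-as-+ᵥ : ∀ {d} (x y : Vect d) → x -ᵥ y ≡ x +ᵥ ((- 1ℚ) ·ᵥ y)
-ᵥ-as-+ᵥ [] [] = refl
-ᵥ-as-+ᵥ (a ∷ x) (b ∷ y) = cong₂ _∷_ (identity a b) (-ᵥ-as-+ᵥ x y)
  where
  identity : ∀ a b → a - b ≡ a + (- 1ℚ) * b
  identity = solve-∀ ℚ-ring

0ᵥ-as-·ᵥ : ∀ d → 0ᵥ {d} ≡ 0ℚ ·ᵥ 0ᵥ
0ᵥ-as-·ᵥ zero = refl
0ᵥ-as-·ᵥ (suc d) = cong₂ _∷_ (sym (*-zeroˡ 0ℚ)) (0ᵥ-as-·ᵥ d)

-ᵥ≡0ᵥ⇒≡ : ∀ {d} (x y : Vect d) → x -ᵥ y ≡ 0ᵥ → x ≡ y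
-ᵥ≡0ᵥ⇒≡ [] [] _ = refl
-ᵥ≡0ᵥ⇒≡ (a ∷ x) (b ∷ y) eq = cong₂ _∷_
  (trans (identity a b) (trans (cong (_+ b) (cong head eq)) (+-identityˡ b)))
  (-ᵥ≡0ᵥ⇒≡ x y (cong tail eq))
  where
  identity : ∀ a b → a ≡ a - b + b
  identity = solve-∀ ℚ-ring

-- Reflections

module Geometry (R : RootSystem) where
  open RS R renaming (refl to reflect; trans to translation)
  open ≡-Reasoning

  _≟ᵥ_ : (x y : V) → Dec (x ≡ y)
  _≟ᵥ_ = ≡-dec _≟_

  ip-subˡ : ∀ x y z → ip (x -ᵥ y) z ≡ ip x z - ip y z
  ip-subˡ x y z = begin
    ip (x -ᵥ y) z                ≡⟨ cong (λ v → ip v z) (-ᵥ-as-+ᵥ x y) ⟩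
    ip (x +ᵥ ((- 1ℚ) ·ᵥ y)) z    ≡⟨ ip-addˡ x _ z ⟩
    ip x z + ip ((- 1ℚ) ·ᵥ y) z  ≡⟨ cong (_+_ (ip x z)) (ip-scalˡ (- 1ℚ) y z) ⟩
    ip x z + (- 1ℚ) * ip y z     ≡⟨ identity (ip x z) (ip y z) ⟩
    ip x z - ip y z              ∎
    where
    identity : ∀ a b → a + (- 1ℚ) * b ≡ a - b
    identity = solve-∀ ℚ-ring

  ip-0ˡ : ∀ z → ip 0ᵥ z ≡ 0ℚ
  ip-0ˡ z = trans (cong (λ v → ip v z) (0ᵥ-as-·ᵥ d)) (trans (ip-scalˡ 0ℚ 0ᵥ z) (*-zeroˡ (ip 0ᵥ z)))

  ip-sub-scalˡ : ∀ x c y z → ip (x -ᵥ (c ·ᵥ y)) z ≡ ip x z - c * ip y z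
  ip-sub-scalˡ x c y z = trans (ip-subˡ x (c ·ᵥ y) z) (cong (λ t → ip x z - t) (ip-scalˡ c y z))

  ip-affine : ∀ x t y z → ip (x +ᵥ (t ·ᵥ y)) z ≡ ip x z + t * ip y z
  ip-affine x t y z = trans (ip-addˡ x (t ·ᵥ y) z) (cong (_+_ (ip x z)) (ip-scalˡ t y z))

  ip-self≥0 : ∀ x → 0ℚ ≤ ip x x
  ip-self≥0 x with x ≟ᵥ 0ᵥ
  ... | yes refl = ≤-reflexive (sym (ip-0ˡ 0ᵥ))
  ... | no x≢0 = <⇒≤ (ip-pos x x≢0)

  -- Definiteness is applied to the difference. Identities between vectors thus become identities
  -- between rationals, where the ring solver applies.
  ip-ext : ∀ {x y} → (∀ z → ip x z ≡ ip y z) → x ≡ y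
  ip-ext {x} {y} eq with (x -ᵥ y) ≟ᵥ 0ᵥ
  ... | yes x-y≡0 = -ᵥ≡0ᵥ⇒≡ x y x-y≡0
  ... | no x-y≢0 = ⊥-elim (<⇒≢ (ip-pos (x -ᵥ y) x-y≢0) (sym (begin
    ip (x -ᵥ y) (x -ᵥ y)           ≡⟨ ip-subˡ x y _ ⟩
    ip x (x -ᵥ y) - ip y (x -ᵥ y)  ≡⟨ cong (_- ip y (x -ᵥ y)) (eq _) ⟩
    ip y (x -ᵥ y) - ip y (x -ᵥ y)  ≡⟨ +-inverseʳ (ip y (x -ᵥ y)) ⟩
    0ℚ                             ∎)))

  -- Here `a` is the inverse of the squared length of `α`, and the coroot is `2ℚ * a` times `α`.
  -- Carrying `a` as a variable with one relation keeps the later computations polynomial.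
  record IsCoroot (α : V) (a : ℚ) : Set where
    constructor ⟨_,_,_⟩
    field
      inverse>0       : 0ℚ < a
      inverse*norm≡1  : a * ip α α ≡ 1ℚ
      ip-cor          : ∀ z → ip (cor α) z ≡ 2ℚ * a * ip α z

  coroot : ∀ {α} → α ∈ Φ → ∃ (IsCoroot α)
  coroot {α} α∈Φ with inverse (ip-pos α λ { refl → Φ-nonzero α∈Φ })
  ... | a , a>0 , a*αα≡1 = a , ⟨ a>0 , a*αα≡1 , (λ z → begin
    ip (cor α) z                     ≡⟨ *-identityˡ (ip (cor α) z) ⟨
    1ℚ * ip (cor α) z                ≡⟨ cong (_* ip (cor α) z) a*αα≡1 ⟨
    a * ip α α * ip (cor α) z        ≡⟨ *-assoc a (ip α α) (ip (cor α) z) ⟩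
    a * (ip α α * ip (cor α) z)      ≡⟨ cong (a *_) (ip-scalˡ (ip α α) (cor α) z) ⟨
    a * ip (ip α α ·ᵥ cor α) z       ≡⟨ cong (λ v → a * ip v z) (cor-def α α∈Φ) ⟩
    a * ip (2ℚ ·ᵥ α) z               ≡⟨ cong (a *_) (ip-scalˡ 2ℚ α z) ⟩
    a * (2ℚ * ip α z)                ≡⟨ identity a 2ℚ (ip α z) ⟩
    2ℚ * a * ip α z                  ∎) ⟩
    where
    identity : ∀ a c t → a * (c * t) ≡ c * a * t
    identity = solve-∀ ℚ-ring

  height : Wall → V → ℚ
  height H y = ip y (root H) - level H

  ip-aref : ∀ H y z → ip (aref H y) z ≡ ip y z - height H y * ip (cor (root H)) z
  ip-aref H y = ip-sub-scalˡ y (height H y) (cor (root H))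

  ip-cor-root : ∀ {α a} → IsCoroot α a → ip (cor α) α ≡ 2ℚ
  ip-cor-root {α} {a} ⟨ _ , a*αα≡1 , cor-a ⟩ = begin
    ip (cor α) α         ≡⟨ cor-a α ⟩
    2ℚ * a * ip α α      ≡⟨ *-assoc 2ℚ a (ip α α) ⟩
    2ℚ * (a * ip α α)    ≡⟨ cong (2ℚ *_) a*αα≡1 ⟩
    2ℚ * 1ℚ              ≡⟨ *-identityʳ 2ℚ ⟩
    2ℚ                   ∎

  height-aref : ∀ H y → root H ∈ Φ → height H (aref H y) ≡ - height H y
  height-aref H y α∈Φ = begin
    ip (aref H y) (root H) - level H                              ≡⟨ cong (_- level H) (ip-aref H y (root H)) ⟩
    ip y (root H) - height H y * ip (cor (root H)) (root H) - level H
      ≡⟨ cong (λ t → ip y (root H) - height H y * t - level H) (ip-cor-root (proj₂ (coroot α∈Φ))) ⟩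
    ip y (root H) - height H y * 2ℚ - level H                     ≡⟨ identity (ip y (root H)) (level H) ⟩
    - height H y                                                  ∎
    where
    identity : ∀ t k → t - (t - k) * (1ℚ + 1ℚ) - k ≡ - (t - k)
    identity = solve-∀ ℚ-ring

  aref-involutive : ∀ H y → root H ∈ Φ → aref H (aref H y) ≡ y
  aref-involutive H y α∈Φ = ip-ext λ z → begin
    ip (aref H (aref H y)) z                                 ≡⟨ ip-aref H (aref H y) z ⟩
    ip (aref H y) z - height H (aref H y) * ip (cor (root H)) z
      ≡⟨ cong₂ (λ s t → s - t * ip (cor (root H)) z) (ip-aref H y z) (height-aref H y α∈Φ) ⟩
    ip y z - height H y * ip (cor (root H)) z - - height H y * ip (cor (root H)) z
      ≡⟨ identity (ip y z) (height H y) (ip (cor (root H)) z) ⟩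
    ip y z ∎
    where
    identity : ∀ t h c → t - h * c - - h * c ≡ t
    identity = solve-∀ ℚ-ring

  aref-fixes : ∀ H y → height H y ≡ 0ℚ → aref H y ≡ y
  aref-fixes H y h≡0 = ip-ext λ z → trans (ip-aref H y z)
    (trans (cong (λ h → ip y z - h * ip (cor (root H)) z) h≡0) (identity (ip y z) (ip (cor (root H)) z)))
    where
    identity : ∀ t c → t - 0ℚ * c ≡ t
    identity = solve-∀ ℚ-ring

  dist² : V → V → ℚ
  dist² x y = ip (y -ᵥ x) (y -ᵥ x)

  dist²-expand : ∀ x y → dist² x y ≡ ip y y - 2ℚ * ip y x + ip x x
  dist²-expand x y = begin
    ip (y -ᵥ x) (y -ᵥ x)                        ≡⟨ ip-subˡ y x _ ⟩
    ip y (y -ᵥ x) - ip x (y -ᵥ x)               ≡⟨ cong₂ _-_ (expandʳ y) (expandʳ x) ⟩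
    (ip y y - ip x y) - (ip y x - ip x x)       ≡⟨ cong (λ t → (ip y y - t) - (ip y x - ip x x)) (ip-sym x y) ⟩
    (ip y y - ip y x) - (ip y x - ip x x)       ≡⟨ identity (ip y y) (ip y x) (ip x x) ⟩
    ip y y - 2ℚ * ip y x + ip x x               ∎
    where
    expandʳ : ∀ u → ip u (y -ᵥ x) ≡ ip y u - ip x u
    expandʳ u = trans (ip-sym u _) (ip-subˡ y x u)
    identity : ∀ yy yx xx → (yy - yx) - (yx - xx) ≡ yy - (1ℚ + 1ℚ) * yx + xx
    identity = solve-∀ ℚ-ring

  ip-aref-root : ∀ H y {a} → IsCoroot (root H) a → ∀ z →
    ip (aref H y) z ≡ ip y z - height H y * (2ℚ * a * ip (root H) z)
  ip-aref-root H y ⟨ _ , _ , cor-a ⟩ z =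
    trans (ip-aref H y z) (cong (λ t → ip y z - height H y * t) (cor-a z))

  -- As `a` is positive, the correction has the sign of the product of the heights: the reflection
  -- brings `y` closer to `x` exactly when `H` strictly separates them.
  dist²-aref : ∀ x H y {a} → IsCoroot (root H) a →
    dist² x (aref H y) ≡ dist² x y + 2ℚ * 2ℚ * (a * height H x * height H y)
  dist²-aref x H y {a} is@(⟨ _ , a*αα≡1 , _ ⟩) = begin
    dist² x y'                                  ≡⟨ dist²-expand x y' ⟩
    ip y' y' - 2ℚ * ip y' x + ip x x            ≡⟨ cong₂ (λ s t → s - 2ℚ * t + ip x x) norm
             (trans (ip-aref-root H y is x) (cong (λ t → ip y x - h * (2ℚ * a * t)) (ip-sym α x))) ⟩
    (ip y y - h * (2ℚ * a * ip y α) - h * (2ℚ * a * (ip y α - h * (2ℚ * a * ip α α))))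
      - 2ℚ * (ip y x - h * (2ℚ * a * ip x α)) + ip x x
      -- The solver knows no relation between its variables, so the surplus is left as a multiple of
      -- `a * ip α α - 1ℚ`, which vanishes in the next steps.
      ≡⟨ identity (ip y y) (ip y x) (ip x x) (ip y α) (ip x α) (level H) a (ip α α) ⟩
    (ip y y - 2ℚ * ip y x + ip x x) + 2ℚ * 2ℚ * (a * height H x * h) + 2ℚ * 2ℚ * a * h * h * (a * ip α α - 1ℚ)
      ≡⟨ cong₂ (λ s t → s + 2ℚ * 2ℚ * (a * height H x * h) + 2ℚ * 2ℚ * a * h * h * (t - 1ℚ)) (sym (dist²-expand x y)) a*αα≡1 ⟩
    dist² x y + 2ℚ * 2ℚ * (a * height H x * h) + 2ℚ * 2ℚ * a * h * h * (1ℚ - 1ℚ)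
      ≡⟨ drop (dist² x y + 2ℚ * 2ℚ * (a * height H x * h)) (2ℚ * 2ℚ * a * h * h) ⟩
    dist² x y + 2ℚ * 2ℚ * (a * height H x * h)  ∎
    where
    α = root H
    h = height H y
    y' = aref H y
    norm : ip y' y' ≡ ip y y - h * (2ℚ * a * ip y α) - h * (2ℚ * a * (ip y α - h * (2ℚ * a * ip α α)))
    norm = trans (ip-aref-root H y is y') (cong₂ (λ s t → s - h * (2ℚ * a * t))
      (trans (ip-sym y y') (trans (ip-aref-root H y is y) (cong (λ t → ip y y - h * (2ℚ * a * t)) (ip-sym α y))))
      (trans (ip-sym α y') (ip-aref-root H y is α)))
    drop : ∀ s t → s + t * (1ℚ - 1ℚ) ≡ s
    drop = solve-∀ ℚ-ring
    identity : ∀ yy yx xx yα xα k a αα →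
      (yy - (yα - k) * ((1ℚ + 1ℚ) * a * yα) - (yα - k) * ((1ℚ + 1ℚ) * a * (yα - (yα - k) * ((1ℚ + 1ℚ) * a * αα))))
        - (1ℚ + 1ℚ) * (yx - (yα - k) * ((1ℚ + 1ℚ) * a * xα)) + xx
      ≡ (yy - (1ℚ + 1ℚ) * yx + xx) + (1ℚ + 1ℚ) * (1ℚ + 1ℚ) * (a * (xα - k) * (yα - k))
        + (1ℚ + 1ℚ) * (1ℚ + 1ℚ) * a * (yα - k) * (yα - k) * (a * αα - 1ℚ)
    identity = solve-∀ ℚ-ring

  -- The bracket is the first of the two quantities in `rotation-closer`; the second belongs to the
  -- composition in the other order.
  dist²-aref-aref : ∀ x H H' y {a b} → IsCoroot (root H) a → IsCoroot (root H') b →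
    let p = height H x; h = height H y; p' = height H' x; h' = height H' y
        e = 2ℚ * a * b * ip (root H) (root H') in
    dist² x (aref H' (aref H y)) ≡ dist² x y + 2ℚ * 2ℚ * (a * p * h + b * p' * h' - e * p' * h)
  dist²-aref-aref x H H' y {a} {b} is is' = begin
    dist² x (aref H' (aref H y))                                 ≡⟨ dist²-aref x H' (aref H y) is' ⟩
    dist² x (aref H y) + 2ℚ * 2ℚ * (b * height H' x * height H' (aref H y))
      ≡⟨ cong₂ (λ s t → s + 2ℚ * 2ℚ * (b * height H' x * (t - level H'))) (dist²-aref x H y is) (ip-aref-root H y is (root H')) ⟩
    dist² x y + 2ℚ * 2ℚ * (a * height H x * height H y)
      + 2ℚ * 2ℚ * (b * height H' x * (ip y (root H') - height H y * (2ℚ * a * ip (root H) (root H')) - level H'))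
      ≡⟨ identity (dist² x y) a b (height H x) (height H y) (height H' x) (ip y (root H')) (level H') (ip (root H) (root H')) ⟩
    _ ∎
    where
    identity : ∀ D a b p h p' yα' k' g →
      D + (1ℚ + 1ℚ) * (1ℚ + 1ℚ) * (a * p * h) + (1ℚ + 1ℚ) * (1ℚ + 1ℚ) * (b * p' * (yα' - h * ((1ℚ + 1ℚ) * a * g) - k'))
      ≡ D + (1ℚ + 1ℚ) * (1ℚ + 1ℚ) * (a * p * h + b * p' * (yα' - k') - (1ℚ + 1ℚ) * a * b * g * p' * h)
    identity = solve-∀ ℚ-ring

  -- This supplies the positivity hypothesis of `rotation-closer`: the bracket is a quarter of a
  -- squared distance, hence positive once the two reflected points differ. Parallel and
  -- intersecting walls are treated alike.
  dist²-between-arefs : ∀ H H' y {a b} → IsCoroot (root H) a → IsCoroot (root H') b →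
    let h = height H y; h' = height H' y
        e = 2ℚ * a * b * ip (root H) (root H') in
    dist² (aref H' y) (aref H y) ≡ 2ℚ * 2ℚ * (a * h * h + b * h' * h' - e * h * h')
  dist²-between-arefs H H' y {a} {b} is@(⟨ _ , a*αα≡1 , _ ⟩) is'@(⟨ _ , b*α'α'≡1 , _ ⟩) = begin
    ip v v                                                       ≡⟨ ip-v v ⟩
    h' * (2ℚ * b * ip α' v) - h * (2ℚ * a * ip α v)
      ≡⟨ cong₂ (λ s t → h' * (2ℚ * b * s) - h * (2ℚ * a * t)) (trans (ip-sym α' v) (ip-v α'))
           (trans (ip-sym α v) (trans (ip-v α) (cong (λ g → h' * (2ℚ * b * g) - h * (2ℚ * a * ip α α)) (ip-sym α' α)))) ⟩
    h' * (2ℚ * b * (h' * (2ℚ * b * ip α' α') - h * (2ℚ * a * ip α α')))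
      - h * (2ℚ * a * (h' * (2ℚ * b * ip α α') - h * (2ℚ * a * ip α α)))
      ≡⟨ identity a b h h' (ip α α') (ip α α) (ip α' α') ⟩
    2ℚ * 2ℚ * (a * h * h * (a * ip α α) + b * h' * h' * (b * ip α' α') - 2ℚ * a * b * ip α α' * h * h')
      ≡⟨ cong₂ (λ s t → 2ℚ * 2ℚ * (a * h * h * s + b * h' * h' * t - 2ℚ * a * b * ip α α' * h * h')) a*αα≡1 b*α'α'≡1 ⟩
    2ℚ * 2ℚ * (a * h * h * 1ℚ + b * h' * h' * 1ℚ - 2ℚ * a * b * ip α α' * h * h')
      ≡⟨ cong₂ (λ s t → 2ℚ * 2ℚ * (s + t - 2ℚ * a * b * ip α α' * h * h')) (*-identityʳ (a * h * h)) (*-identityʳ (b * h' * h')) ⟩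
    _ ∎
    where
    α = root H
    α' = root H'
    h = height H y
    h' = height H' y
    v = aref H y -ᵥ aref H' y
    ip-v : ∀ z → ip v z ≡ h' * (2ℚ * b * ip α' z) - h * (2ℚ * a * ip α z)
    ip-v z = trans (ip-subˡ (aref H y) (aref H' y) z)
      (trans (cong₂ _-_ (ip-aref-root H y is z) (ip-aref-root H' y is' z)) (cancel (ip y z) _ _))
      where
      cancel : ∀ t r s → (t - r) - (t - s) ≡ s - r
      cancel = solve-∀ ℚ-ring
    identity : ∀ a b h h' g αα α'α' →
      h' * ((1ℚ + 1ℚ) * b * (h' * ((1ℚ + 1ℚ) * b * α'α') - h * ((1ℚ + 1ℚ) * a * g)))
        - h * ((1ℚ + 1ℚ) * a * (h' * ((1ℚ + 1ℚ) * b * g) - h * ((1ℚ + 1ℚ) * a * αα)))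
      ≡ (1ℚ + 1ℚ) * (1ℚ + 1ℚ) * (a * h * h * (a * αα) + b * h' * h' * (b * α'α') - (1ℚ + 1ℚ) * a * b * g * h * h')
    identity = solve-∀ ℚ-ring

  ip-reflect : ∀ α y z → ip (reflect α y) z ≡ ip y z - ip y α * ip (cor α) z
  ip-reflect α y = ip-sub-scalˡ y (ip y α) (cor α)

  isWall-reflWall : ∀ H H' → IsWall H → IsWall H' → IsWall (reflWall H H')
  isWall-reflWall H H' (α∈Φ , k-int) (α'∈Φ , k'-int) =
    Φ-refl (root H) (root H') α∈Φ α'∈Φ , int-- k'-int (int-* k-int (Φ-cryst (root H) (root H') α∈Φ α'∈Φ))

  ip-reflect-self : ∀ {α a} → IsCoroot α a → ∀ u → ip (reflect α u) (reflect α u) ≡ ip u u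
  ip-reflect-self {α} {a} (⟨ _ , a*αα≡1 , cor-a ⟩) u = begin
    ip u' u'                                     ≡⟨ formula u' ⟩
    ip u u' - ip u α * (2ℚ * a * ip α u')
      ≡⟨ cong₂ (λ s t → s - ip u α * (2ℚ * a * t)) (trans (ip-sym u u') (formula u)) (trans (ip-sym α u') (formula α)) ⟩
    (ip u u - ip u α * (2ℚ * a * ip α u)) - ip u α * (2ℚ * a * (ip u α - ip u α * (2ℚ * a * ip α α)))
      ≡⟨ cong (λ t → (ip u u - ip u α * (2ℚ * a * t)) - ip u α * (2ℚ * a * (ip u α - ip u α * (2ℚ * a * ip α α)))) (ip-sym α u) ⟩
    (ip u u - ip u α * (2ℚ * a * ip u α)) - ip u α * (2ℚ * a * (ip u α - ip u α * (2ℚ * a * ip α α)))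
      ≡⟨ identity (ip u u) (ip u α) a (ip α α) ⟩
    ip u u + 2ℚ * 2ℚ * a * ip u α * ip u α * (a * ip α α - 1ℚ)  ≡⟨ cong (λ t → ip u u + 2ℚ * 2ℚ * a * ip u α * ip u α * (t - 1ℚ)) a*αα≡1 ⟩
    ip u u + 2ℚ * 2ℚ * a * ip u α * ip u α * (1ℚ - 1ℚ)          ≡⟨ drop (ip u u) (2ℚ * 2ℚ * a * ip u α * ip u α) ⟩
    ip u u ∎
    where
    u' = reflect α u
    formula : ∀ z → ip u' z ≡ ip u z - ip u α * (2ℚ * a * ip α z)
    formula z = trans (ip-reflect α u z) (cong (λ t → ip u z - ip u α * t) (cor-a z))
    drop : ∀ s t → s + t * (1ℚ - 1ℚ) ≡ s
    drop = solve-∀ ℚ-ring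
    identity : ∀ uu uα a αα →
      (uu - uα * ((1ℚ + 1ℚ) * a * uα)) - uα * ((1ℚ + 1ℚ) * a * (uα - uα * ((1ℚ + 1ℚ) * a * αα)))
      ≡ uu + (1ℚ + 1ℚ) * (1ℚ + 1ℚ) * a * uα * uα * (a * αα - 1ℚ)
    identity = solve-∀ ℚ-ring

  isCoroot-unique : ∀ {α β a b} → IsCoroot α a → IsCoroot β b → ip β β ≡ ip α α → b ≡ a
  isCoroot-unique {α} {β} {a} {b} ⟨ _ , a*αα≡1 , _ ⟩ ⟨ _ , b*ββ≡1 , _ ⟩ eq = begin
    b                  ≡⟨ *-identityʳ b ⟨
    b * 1ℚ             ≡⟨ cong (b *_) a*αα≡1 ⟨
    b * (a * ip α α)   ≡⟨ identity a b (ip α α) ⟩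
    a * (b * ip α α)   ≡⟨ cong (λ t → a * (b * t)) eq ⟨
    a * (b * ip β β)   ≡⟨ cong (a *_) b*ββ≡1 ⟩
    a * 1ℚ             ≡⟨ *-identityʳ a ⟩
    a ∎
    where
    identity : ∀ a b t → b * (a * t) ≡ a * (b * t)
    identity = solve-∀ ℚ-ring

  ip-aref-reflWall : ∀ H H' y {a b} → root H' ∈ Φ →
    IsCoroot (root H) a → IsCoroot (root H') b → IsCoroot (root (reflWall H' H)) a →
    ∀ z → ip (aref (reflWall H' H) (aref H' y)) z ≡ ip (aref H' (aref H y)) z
  ip-aref-reflWall H H' y {a} {b} α'∈Φ is is'@(⟨ _ , _ , cor-b ⟩) is-β z = begin
    ip (aref K y₂) z
      ≡⟨ ip-aref-root K y₂ is-β z ⟩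
    ip y₂ z - height K y₂ * (2ℚ * a * ip β z)
      ≡⟨ cong₂ (λ s t → ip y₂ z - s * (2ℚ * a * t)) height-K (ip-β z) ⟩
    ip y₂ z - h * (2ℚ * a * (ip α z - ip α α' * (2ℚ * b * ip α' z)))
      ≡⟨ cong (λ t → t - h * (2ℚ * a * (ip α z - ip α α' * (2ℚ * b * ip α' z)))) (ip-aref-root H' y is' z) ⟩
    (ip y z - h' * (2ℚ * b * ip α' z)) - h * (2ℚ * a * (ip α z - ip α α' * (2ℚ * b * ip α' z)))
      ≡⟨ identity (ip y z) (ip y α') (level H') h (ip α z) (ip α' z) a b (ip α α') ⟩
    (ip y z - h * (2ℚ * a * ip α z)) - (ip y α' - h * (2ℚ * a * ip α α') - level H') * (2ℚ * b * ip α' z)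
      ≡⟨ cong₂ (λ s t → s - (t - level H') * (2ℚ * b * ip α' z)) (ip-aref-root H y is z) (ip-aref-root H y is α') ⟨
    ip (aref H y) z - height H' (aref H y) * (2ℚ * b * ip α' z)
      ≡⟨ ip-aref-root H' (aref H y) is' z ⟨
    ip (aref H' (aref H y)) z ∎
    where
    α = root H
    α' = root H'
    K = reflWall H' H
    β = root K
    h = height H y
    h' = height H' y
    y₂ = aref H' y
    ip-β : ∀ z → ip β z ≡ ip α z - ip α α' * (2ℚ * b * ip α' z)
    ip-β z = trans (ip-reflect α' α z) (cong (λ t → ip α z - ip α α' * t) (cor-b z))
    height-K : height K y₂ ≡ h
    height-K = begin
      ip y₂ β - (level H - level H' * ip α (cor α'))
        ≡⟨ cong₂ (λ s t → s - (level H - level H' * t)) (trans (ip-sym y₂ β) (ip-β y₂)) (trans (ip-sym α (cor α')) (cor-b α)) ⟩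
      (ip α y₂ - ip α α' * (2ℚ * b * ip α' y₂)) - (level H - level H' * (2ℚ * b * ip α' α))
        ≡⟨ cong₂ (λ s t → (s - ip α α' * (2ℚ * b * ip α' y₂)) - (level H - level H' * (2ℚ * b * t)))
                 (trans (ip-sym α y₂) (ip-aref-root H' y is' α)) (ip-sym α' α) ⟩
      (ip y α - h' * (2ℚ * b * ip α' α) - ip α α' * (2ℚ * b * ip α' y₂)) - (level H - level H' * (2ℚ * b * ip α α'))
        ≡⟨ cong₂ (λ s t → (ip y α - h' * (2ℚ * b * s) - ip α α' * (2ℚ * b * t)) - (level H - level H' * (2ℚ * b * ip α α')))
                 (ip-sym α' α) (trans (ip-sym α' y₂) reflected) ⟩
      (ip y α - h' * (2ℚ * b * ip α α') - ip α α' * (2ℚ * b * (level H' - h'))) - (level H - level H' * (2ℚ * b * ip α α'))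
        ≡⟨ collect (ip y α) h' b (ip α α') (level H) (level H') ⟩
      ip y α - level H ∎
      where
      reflected : ip y₂ α' ≡ level H' - h'
      reflected = trans (split (ip y₂ α') (level H')) (cong (λ t → level H' + t) (height-aref H' y α'∈Φ))
        where
        split : ∀ t k → t ≡ k + (t - k)
        split = solve-∀ ℚ-ring
      collect : ∀ yα h' b g k k' →
        (yα - h' * ((1ℚ + 1ℚ) * b * g) - g * ((1ℚ + 1ℚ) * b * (k' - h'))) - (k - k' * ((1ℚ + 1ℚ) * b * g)) ≡ yα - k
      collect = solve-∀ ℚ-ring
    identity : ∀ yz yα' k' h αz α'z a b g →
      (yz - (yα' - k') * ((1ℚ + 1ℚ) * b * α'z)) - h * ((1ℚ + 1ℚ) * a * (αz - g * ((1ℚ + 1ℚ) * b * α'z)))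
      ≡ (yz - h * ((1ℚ + 1ℚ) * a * αz)) - (yα' - h * ((1ℚ + 1ℚ) * a * g) - k') * ((1ℚ + 1ℚ) * b * α'z)
    identity = solve-∀ ℚ-ring

  -- Reflections are conjugated by reflecting their walls. A reflected root keeps its length, so the
  -- same inverse `a` serves for `H` and for `reflWall H' H`.
  aref-reflWall : ∀ H H' y → IsWall H → IsWall H' →
    aref (reflWall H' H) (aref H' y) ≡ aref H' (aref H y)
  aref-reflWall H H' y (α∈Φ , _) (α'∈Φ , _) = ip-ext
    (ip-aref-reflWall H H' y α'∈Φ is (proj₂ (coroot α'∈Φ))
      (subst (IsCoroot (reflect (root H') (root H)))
        (isCoroot-unique is is-β (ip-reflect-self (proj₂ (coroot α'∈Φ)) (root H))) is-β))
    where
    is = proj₂ (coroot α∈Φ)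
    is-β = proj₂ (coroot (Φ-refl (root H') (root H) α'∈Φ α∈Φ))

  -- The group generated by the reflections and its fundamental alcove

  _~_ : V → V → Set
  y ~ y' = ∃[ H ] (IsWall H × y' ≡ aref H y)

  _≈W_ : V → V → Set
  _≈W_ = Star _~_

  ~-sym : ∀ {y y'} → y ~ y' → y' ~ y
  ~-sym (H , isH , refl) = H , isH , sym (aref-involutive H _ (proj₁ isH))

  Generic : V → Set
  Generic x = ∀ α → α ∈ Φ⁺ → 0ℚ < ip x α × ip x α < 1ℚ

  -- The opposite root is written `reflect α α`, since in this form `Φ-refl` shows it to be a root.
  ip-opposite : ∀ {α a} → IsCoroot α a → ∀ z → ip z α ≡ - ip z (reflect α α)
  ip-opposite {α} {a} (⟨ _ , a*αα≡1 , cor-a ⟩) z = begin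
    ip z α                                         ≡⟨ identity (ip z α) ⟩
    - (ip z α - 1ℚ * (2ℚ * ip z α))                ≡⟨ cong (λ t → - (ip z α - t * (2ℚ * ip z α))) a*αα≡1 ⟨
    - (ip z α - a * ip α α * (2ℚ * ip z α))        ≡⟨ cong₂ (λ s t → - (s - a * ip α α * (2ℚ * t))) (ip-sym z α) (ip-sym z α) ⟩
    - (ip α z - a * ip α α * (2ℚ * ip α z))        ≡⟨ cong (λ t → - (ip α z - t)) (regroup a (ip α α) 2ℚ (ip α z)) ⟩
    - (ip α z - ip α α * (2ℚ * a * ip α z))        ≡⟨ cong (λ t → - (ip α z - ip α α * t)) (cor-a z) ⟨
    - (ip α z - ip α α * ip (cor α) z)             ≡⟨ cong -_ (ip-reflect α α z) ⟨
    - ip (reflect α α) z                           ≡⟨ cong -_ (ip-sym (reflect α α) z) ⟩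
    - ip z (reflect α α)                           ∎
    where
    identity : ∀ t → t ≡ - (t - 1ℚ * ((1ℚ + 1ℚ) * t))
    identity = solve-∀ ℚ-ring
    regroup : ∀ a g c t → a * g * (c * t) ≡ g * (c * a * t)
    regroup = solve-∀ ℚ-ring

  ±Φ⁺ : ∀ {α} → α ∈ Φ → α ∈ Φ⁺ ⊎ ∃[ β ] (β ∈ Φ⁺ × (∀ z → ip z α ≡ - ip z β))
  ±Φ⁺ {α} α∈Φ with Φ⁺-positive
  ... | ξ , ξα≢0 , char with <-cmp 0ℚ (ip ξ α)
  ...   | tri< ξα>0 _ _ = inj₁ (proj₂ (char α) (α∈Φ , ξα>0))
  ...   | tri≈ _ 0≡ξα _ = ⊥-elim (ξα≢0 α α∈Φ (sym 0≡ξα))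
  ...   | tri> _ _ ξα<0 = inj₂ (reflect α α ,
            proj₂ (char _) (Φ-refl α α α∈Φ α∈Φ ,
              subst (0ℚ <_) (trans (cong -_ (opposite ξ)) (neg-involutive _)) (neg-antimono-< ξα<0)) ,
            opposite)
    where
    opposite = ip-opposite (proj₂ (coroot α∈Φ))
    neg-involutive : ∀ q → - (- q) ≡ q
    neg-involutive = solve-∀ ℚ-ring

  height-opposite : ∀ H {β} → (∀ z → ip z (root H) ≡ - ip z β) → ∀ y → - (ip y β - - level H) ≡ height H y
  height-opposite H {β} opposite y = trans (identity (ip y β) (level H)) (cong (_- level H) (sym (opposite y)))
    where
    identity : ∀ t k → - (t - - k) ≡ - t - k
    identity = solve-∀ ℚ-ring

  -- The pairing with a positive root lies between 0 and 1 on the alcove, and levels are integers. A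
  -- negative root is replaced by its opposite, which negates the level and swaps the sides.
  alcove-side : ∀ H → IsWall H →
    ((∀ y → InCf y → 0ℚ ≤ height H y) × (∀ x → Generic x → 0ℚ < height H x)) ⊎
    ((∀ y → InCf y → height H y ≤ 0ℚ) × (∀ x → Generic x → height H x < 0ℚ))
  alcove-side H (α∈Φ , k-int) with ±Φ⁺ α∈Φ
  ... | inj₁ α∈Φ⁺ with unit-interval-side (level H) k-int
  ...   | inj₁ (above , strictly) = inj₁
          ((λ y y∈ → above _ (proj₁ (y∈ _ α∈Φ⁺))) , λ x x∈ → strictly _ (proj₁ (x∈ _ α∈Φ⁺)))
  ...   | inj₂ (below , strictly) = inj₂
          ((λ y y∈ → below _ (proj₂ (y∈ _ α∈Φ⁺))) , λ x x∈ → strictly _ (proj₂ (x∈ _ α∈Φ⁺)))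
  alcove-side H (α∈Φ , k-int) | inj₂ (β , β∈Φ⁺ , opposite) with unit-interval-side (- level H) (int-neg k-int)
  ...   | inj₁ (above , strictly) = inj₂
          ((λ y y∈ → subst (_≤ 0ℚ) (height-opposite H opposite y) (neg-antimono-≤ (above _ (proj₁ (y∈ β β∈Φ⁺))))) ,
           (λ x x∈ → subst (_< 0ℚ) (height-opposite H opposite x) (neg-antimono-< (strictly _ (proj₁ (x∈ β β∈Φ⁺))))))
  ...   | inj₂ (below , strictly) = inj₁
          ((λ y y∈ → subst (0ℚ ≤_) (height-opposite H opposite y) (neg-antimono-≤ (below _ (proj₂ (y∈ β β∈Φ⁺))))) ,
           (λ x x∈ → subst (0ℚ <_) (height-opposite H opposite x) (neg-antimono-< (strictly _ (proj₂ (x∈ β β∈Φ⁺))))))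

  -- N clears the denominators that occur in the distances to x along an orbit.
  module Folding (x : V) (x-generic : Generic x) (N : ℚ) (N>0 : 0ℚ < N) (N-int : IsInt N)
    (N-cor : ∀ α → α ∈ Φ → IsInt (N * ip (cor α) (cor α))) (N-x : ∀ α → α ∈ Φ → IsInt (N * ip x α)) where

    -- A reflection changes the squared distance by the squared length of a coroot times two
    -- heights; each of these three takes one factor `N`.
    M : ℚ
    M = N * N * N

    M>0 : 0ℚ < M
    M>0 = pos*pos>0 (pos*pos>0 N>0 N>0) N>0

    -- The pairings with the roots are carried along because the heights, and with them the next
    -- change of distance, depend on them. Crystallographicity keeps them integral after scaling by
    -- `N`.
    Discrete : V → Set
    Discrete y = (∀ α → α ∈ Φ → IsInt (N * ip y α)) × IsInt (M * dist² x y)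

    int-height : ∀ H → IsWall H → ∀ y → IsInt (N * ip y (root H)) → IsInt (N * height H y)
    int-height H (_ , k-int) y Ny = subst IsInt (identity N (ip y (root H)) (level H)) (int-- Ny (int-* N-int k-int))
      where
      identity : ∀ N t k → N * t - N * k ≡ N * (t - k)
      identity = solve-∀ ℚ-ring

    cor-norm : ∀ {α a} → IsCoroot α a → ip (cor α) (cor α) ≡ 2ℚ * 2ℚ * a
    cor-norm {α} {a} ⟨ _ , a*αα≡1 , cor-a ⟩ = begin
      ip (cor α) (cor α)                      ≡⟨ cor-a (cor α) ⟩
      2ℚ * a * ip α (cor α)                   ≡⟨ cong (2ℚ * a *_) (trans (ip-sym α (cor α)) (cor-a α)) ⟩
      2ℚ * a * (2ℚ * a * ip α α)              ≡⟨ identity 2ℚ a (ip α α) ⟩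
      2ℚ * 2ℚ * a * (a * ip α α)              ≡⟨ cong (2ℚ * 2ℚ * a *_) a*αα≡1 ⟩
      2ℚ * 2ℚ * a * 1ℚ                        ≡⟨ *-identityʳ (2ℚ * 2ℚ * a) ⟩
      2ℚ * 2ℚ * a                             ∎
      where
      identity : ∀ c a t → c * a * (c * a * t) ≡ c * c * a * (a * t)
      identity = solve-∀ ℚ-ring

    int-dist² : ∀ {y a} H → IsWall H → Discrete y → IsCoroot (root H) a → IsInt (M * dist² x (aref H y))
    int-dist² {y} {a} H isH@(α∈Φ , _) (Ny , My) is = subst IsInt (begin
      M * dist² x y + N * ip (cor (root H)) (cor (root H)) * (N * height H x) * (N * height H y)
        ≡⟨ cong (λ t → M * dist² x y + N * t * (N * height H x) * (N * height H y)) (cor-norm is) ⟩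
      M * dist² x y + N * (2ℚ * 2ℚ * a) * (N * height H x) * (N * height H y)
        ≡⟨ identity N (dist² x y) (2ℚ * 2ℚ) a (height H x) (height H y) ⟩
      M * (dist² x y + 2ℚ * 2ℚ * (a * height H x * height H y))
        ≡⟨ cong (M *_) (dist²-aref x H y is) ⟨
      M * dist² x (aref H y) ∎)
      (int-+ My (int-* (int-* (N-cor (root H) α∈Φ) (int-height H isH x (N-x (root H) α∈Φ)))
                       (int-height H isH y (Ny (root H) α∈Φ))))
      where
      identity : ∀ N D c a p h →
        N * N * N * D + N * (c * a) * (N * p) * (N * h) ≡ N * N * N * (D + c * (a * p * h))
      identity = solve-∀ ℚ-ring

    discrete-aref : ∀ {y} H → IsWall H → Discrete y → Discrete (aref H y)
    discrete-aref {y} H isH@(α∈Φ , _) disc@(Ny , _) = pairing , int-dist² H isH disc (proj₂ (coroot α∈Φ))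
      where
      pairing : ∀ β → β ∈ Φ → IsInt (N * ip (aref H y) β)
      pairing β β∈Φ = subst IsInt
        (sym (trans (cong (N *_) (ip-aref H y β)) (identity N (ip y β) (height H y) (ip (cor (root H)) β))))
        (int-- (Ny β β∈Φ) (int-* (int-height H isH y (Ny (root H) α∈Φ))
          (subst IsInt (ip-sym β (cor (root H))) (Φ-cryst (root H) β α∈Φ β∈Φ))))
        where
        identity : ∀ N t h c → N * (t - h * c) ≡ N * t - N * h * c
        identity = solve-∀ ℚ-ring

    _⟶_ : V → V → Set
    y ⟶ y' = Discrete y × ∃[ H ] (IsWall H × height H x * height H y < 0ℚ × y' ≡ aref H y)

    -- With discreteness built in, the relation is well-founded on all of `V`: a point that is not
    -- discrete has nothing below it.
    _≺_ : V → V → Set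
    y' ≺ y = Discrete y × Discrete y' × dist² x y' < dist² x y

    closer : ∀ {D t} → t < 0ℚ → D + 2ℚ * 2ℚ * t < D
    closer {D} {t} t<0 = subst (D + 2ℚ * 2ℚ * t <_) (+-identityʳ D)
      (+-monoʳ-< D (pos*neg<0 (pos*pos>0 2>0 2>0) t<0))
      where
      2>0 : 0ℚ < 2ℚ
      2>0 = positive⁻¹ 2ℚ

    dist²-aref-< : ∀ {y a} H → IsCoroot (root H) a → height H x * height H y < 0ℚ → dist² x (aref H y) < dist² x y
    dist²-aref-< {y} {a} H is@(⟨ a>0 , _ , _ ⟩) sep = subst (_< dist² x y) (sym (dist²-aref x H y is)) (closer
      (subst (_< 0ℚ) (sym (*-assoc a (height H x) (height H y))) (pos*neg<0 a>0 sep)))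

    dist²-decreasing : ∀ {y y'} → y ⟶ y' → y' ≺ y
    dist²-decreasing {y} (disc , H , isH , sep , refl) =
      disc , discrete-aref H isH disc , dist²-aref-< H (proj₂ (coroot (proj₁ isH))) sep

    -- The scaled squared distance is a nonnegative integer, so a strict decrease lowers it by at
    -- least 1 and the bound `n` can drop with it.
    ≺-acc : ∀ n {y} → Discrete y → M * dist² x y < fromℤ (+ n) → Acc _≺_ y
    ≺-acc zero {y} _ lt = ⊥-elim (<-irrefl refl (<-≤-trans lt
      (nonNeg*nonNeg≥0 (<⇒≤ M>0) (ip-self≥0 (y -ᵥ x)))))
    ≺-acc (suc n) (_ , k , Dy≡k) lt = acc λ { {y'} (_ , disc'@(_ , k' , Dy'≡k') , closer) →
      ≺-acc n disc' (subst (_< fromℤ (+ n)) (sym Dy'≡k') (fromℤ-mono-< {k'} {+ n} (ℤ.<-≤-trans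
        (fromℤ-cancel-< {k'} {k} (subst₂ _<_ Dy'≡k' Dy≡k (*-monoʳ-<-pos M {{positive M>0}} closer)))
        (ℤ.i<j⇒i≤pred[j] (fromℤ-cancel-< {k} {+ suc n} (subst (_< fromℤ (+ suc n)) Dy≡k lt)))))) }

    ≺-wellFounded : WellFounded _≺_
    ≺-wellFounded y = acc λ { (_ , disc@(_ , k , D≡k) , _) → ≺-acc (suc ℤ.∣ k ∣) disc
      (subst (_< fromℤ (+ suc ℤ.∣ k ∣)) (sym D≡k) (fromℤ-mono-< {k} {+ suc ℤ.∣ k ∣} (i<1+∣i∣ k))) }

    open Confluence _⟶_ _≺_ ≺-wellFounded dist²-decreasing (λ a b → decidable-stable (a ≟ᵥ b))

    generic≢0 : ∀ H → IsWall H → height H x ≢ 0ℚ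
    generic≢0 H isH with alcove-side H isH
    ... | inj₁ (_ , above) = <⇒≢ (above x x-generic) ∘ sym
    ... | inj₂ (_ , below) = <⇒≢ (below x x-generic)

    -- If `H` separates `y` from `x`, the reflection is a rewriting; if both lie strictly on one
    -- side, it is the inverse of one. In the remaining case `y` lies on `H`, because the generic
    -- `x` does not.
    ~⇒Edge : ∀ {y y'} → Discrete y → y ~ y' → Edge y y'
    ~⇒Edge {y} disc (H , isH , refl) with <-cmp (height H x * height H y) 0ℚ
    ... | tri< sep _ _ = inj₁ (disc , H , isH , sep , refl)
    ... | tri> _ _ same = inj₂ (inj₁ (discrete-aref H isH disc , H , isH ,
          subst (_< 0ℚ) (trans (neg-distribʳ-* (height H x) (height H y)) (cong (height H x *_) (sym (height-aref H y (proj₁ isH)))))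
            (neg-antimono-< same) ,
          sym (aref-involutive H y (proj₁ isH))))
    ... | tri≈ _ prod≡0 _ = inj₂ (inj₂ (sym (aref-fixes H y (zero-factor (generic≢0 H isH) prod≡0))))

    Edge-sym : ∀ {y y'} → Edge y y' → Edge y' y
    Edge-sym (inj₁ y⟶y') = inj₂ (inj₁ y⟶y')
    Edge-sym (inj₂ (inj₁ y'⟶y)) = inj₁ y'⟶y
    Edge-sym (inj₂ (inj₂ y≡y')) = inj₂ (inj₂ (sym y≡y'))

    bridge : ∀ {y} H H' {a b} → Discrete y → IsWall H → IsWall H' →
      IsCoroot (root H) a → IsCoroot (root H') b →
      a * height H x * height H y + b * height H' x * height H' y
        - 2ℚ * a * b * ip (root H) (root H') * height H' x * height H y < 0ℚ →
      ∃[ d ] (d ≺ y × Edge (aref H y) d × Edge d (aref H' y))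
    bridge {y} H H' disc isH isH' is is' A<0 =
      aref H' (aref H y) ,
      (disc , disc-d , subst (_< dist² x y) (sym (dist²-aref-aref x H H' y is is')) (closer A<0)) ,
      ~⇒Edge (discrete-aref H isH disc) (H' , isH' , refl) ,
      -- The reflection in `reflWall H' H` takes `aref H' y` to the bridging point; the edge is this
      -- reflection reversed.
      ~⇒Edge disc-d (~-sym (reflWall H' H , isWall-reflWall H' H isH' isH , sym (aref-reflWall H H' y isH isH')))
      where
      disc-d = discrete-aref H' isH' (discrete-aref H isH disc)

    separating-pair : ∀ {y} H H' {a b} → Discrete y → IsWall H → IsWall H' →
      height H x * height H y < 0ℚ → height H' x * height H' y < 0ℚ → aref H y ≢ aref H' y →
      IsCoroot (root H) a → IsCoroot (root H') b →
      ∃[ d ] (d ≺ y × Edge (aref H y) d × Edge d (aref H' y))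
    separating-pair {y} H H' {a} {b} disc isH isH' sep sep' y₁≢y₂ is@(⟨ a>0 , _ , _ ⟩) is'@(⟨ b>0 , _ , _ ⟩) =
      -- In the second case the walls exchange roles, and the bridge is read backwards. The cross
      -- term `e` is symmetric up to the rearrangement `e≡e'`.
      [ bridge H H' disc isH isH' is is' , backwards ∘ bridge H' H disc isH' isH is' is ∘ subst B<0 e≡e' ]′
        (rotation-closer a b e (height H x) (height H y) (height H' x) (height H' y) a>0 b>0 sep sep' Q>0)
      where
      e = 2ℚ * a * b * ip (root H) (root H')
      4>0 : 0ℚ < 2ℚ * 2ℚ
      4>0 = positive⁻¹ (2ℚ * 2ℚ)
      Q>0 = *-cancelˡ-<-nonNeg (2ℚ * 2ℚ) {{nonNegative (<⇒≤ 4>0)}}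
        (subst₂ _<_ (sym (*-zeroʳ (2ℚ * 2ℚ))) (dist²-between-arefs H H' y is is')
          (ip-pos _ (y₁≢y₂ ∘ -ᵥ≡0ᵥ⇒≡ (aref H y) (aref H' y))))
      B<0 : ℚ → Set
      B<0 e = b * height H' x * height H' y + a * height H x * height H y - e * height H x * height H' y < 0ℚ
      swap : ∀ c a b g → c * a * b * g ≡ c * b * a * g
      swap = solve-∀ ℚ-ring
      e≡e' : e ≡ 2ℚ * b * a * ip (root H') (root H)
      e≡e' = trans (swap 2ℚ a b (ip (root H) (root H'))) (cong (2ℚ * b * a *_) (ip-sym (root H) (root H')))
      backwards : ∃[ d ] (d ≺ y × Edge (aref H' y) d × Edge d (aref H y)) →
                  ∃[ d ] (d ≺ y × Edge (aref H y) d × Edge d (aref H' y))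
      backwards (d , d≺y , y₂d , dy₁) = d , d≺y , Edge-sym dy₁ , Edge-sym y₂d

    peak : ∀ {y y₁ y₂} → y ⟶ y₁ → y ⟶ y₂ → y₁ ≡ y₂ ⊎ ∃[ d ] (d ≺ y × Edge y₁ d × Edge d y₂)
    peak {y} (disc , H , isH , sep , refl) (_ , H' , isH' , sep' , refl) with aref H y ≟ᵥ aref H' y
    ... | yes y₁≡y₂ = inj₁ y₁≡y₂
    ... | no y₁≢y₂ = inj₂ (separating-pair H H' disc isH isH' sep sep' y₁≢y₂
            (proj₂ (coroot (proj₁ isH))) (proj₂ (coroot (proj₁ isH'))))

    normal : ∀ {y} → InCf y → Normal peak y
    normal {y} y∈ _ (_ , H , isH , sep , _) with alcove-side H isH
    ... | inj₁ (y≥0 , x>0) = <-irrefl refl (<-≤-trans sep (nonNeg*nonNeg≥0 (<⇒≤ (x>0 x x-generic)) (y≥0 y y∈)))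
    ... | inj₂ (y≤0 , x<0) = <-irrefl refl (<-≤-trans sep (nonPos*nonPos≥0 (<⇒≤ (x<0 x x-generic)) (y≤0 y y∈)))

    ≈W⇒Edges : ∀ {y y'} → Discrete y → y ≈W y' → Star Edge y y'
    ≈W⇒Edges _ ε = ε
    ≈W⇒Edges disc (y~@(H , isH , refl) ◅ rest) = ~⇒Edge disc y~ ◅ ≈W⇒Edges (discrete-aref H isH disc) rest

    discrete-orbit-meets-alcove-once : ∀ {y y'} → Discrete y → InCf y → InCf y' → y ≈W y' → y ≡ y'
    discrete-orbit-meets-alcove-once disc y∈ y'∈ y≈y' =
      convertible-normal-unique peak (≈W⇒Edges disc y≈y') (normal y∈) (normal y'∈)

  generic-point : ∃ Generic
  generic-point with Φ⁺-positive
  -- The point is a small multiple of the vector `ξ` that defines the positive roots. The weak bound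
  -- by `½` yields the strict bound by 1.
  ... | ξ , _ , char with small-multiples (List.map (λ α → ½ , ip ξ α) Φ⁺) (All.map⁺ (All.universal (λ _ → positive⁻¹ ½) Φ⁺))
  ...   | t , t>0 , small = t ·ᵥ ξ , λ α α∈Φ⁺ →
          subst (0ℚ <_) (sym (ip-scalˡ t ξ α)) (pos*pos>0 t>0 (proj₂ (proj₁ (char α) α∈Φ⁺))) ,
          subst (_< 1ℚ) (sym (ip-scalˡ t ξ α))
            (≤-<-trans (All.lookup (All.map⁻ (small t (<⇒≤ t>0) ≤-refl)) α∈Φ⁺) (from-yes (½ <? 1ℚ)))

  alcove-fundamental : ∀ {y y'} → InCf y → InCf y' → y ≈W y' → y ≡ y'
  alcove-fundamental {y} y∈ y'∈ y≈y' = discrete-orbit-meets-alcove-once discrete y∈ y'∈ y≈y'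
    where
    x = proj₁ generic-point
    cors = List.map (λ α → ip (cor α) (cor α)) Φ
    xs = List.map (ip x) Φ
    ys = List.map (ip y) Φ
    -- One `N` for the initial distance, the squared lengths of the coroots and the pairings of both
    -- points with the roots: finitely many numbers control the whole orbit.
    scale = common-denominator (dist² x y ∷ cors ++ xs ++ ys)
    N = proj₁ scale
    N>0 = proj₁ (proj₂ scale)
    N-int = proj₁ (proj₂ (proj₂ scale))
    cleared = proj₂ (proj₂ (proj₂ scale))
    N-points = All.++⁻ʳ cors (All.tail cleared)
    open Folding x (proj₂ generic-point) N N>0 N-int
      (λ _ → All.lookup (All.map⁻ (All.++⁻ˡ cors (All.tail cleared))))
      (λ _ → All.lookup (All.map⁻ (All.++⁻ˡ xs N-points)))
    discrete : Discrete y
    discrete = (λ _ → All.lookup (All.map⁻ (All.++⁻ʳ xs N-points))) ,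
      subst IsInt (sym (*-assoc (N * N) N (dist² x y))) (int-* (int-* N-int N-int) (All.head cleared))

  -- Affine maps composed of reflections

  reflect-affine : ∀ α y t v → reflect α (y +ᵥ (t ·ᵥ v)) ≡ reflect α y +ᵥ (t ·ᵥ reflect α v)
  reflect-affine α y t v = ip-ext λ z → begin
    ip (reflect α (y +ᵥ (t ·ᵥ v))) z
      ≡⟨ ip-reflect α (y +ᵥ (t ·ᵥ v)) z ⟩
    ip (y +ᵥ (t ·ᵥ v)) z - ip (y +ᵥ (t ·ᵥ v)) α * ip (cor α) z
      ≡⟨ cong₂ (λ r s → r - s * ip (cor α) z) (ip-affine y t v z) (ip-affine y t v α) ⟩
    ip y z + t * ip v z - (ip y α + t * ip v α) * ip (cor α) z
      ≡⟨ identity (ip y z) (ip y α) t (ip v z) (ip v α) (ip (cor α) z) ⟩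
    ip y z - ip y α * ip (cor α) z + t * (ip v z - ip v α * ip (cor α) z)
      ≡⟨ cong₂ (λ r s → r + t * s) (ip-reflect α y z) (ip-reflect α v z) ⟨
    ip (reflect α y) z + t * ip (reflect α v) z
      ≡⟨ ip-affine (reflect α y) t (reflect α v) z ⟨
    ip (reflect α y +ᵥ (t ·ᵥ reflect α v)) z ∎
    where
    identity : ∀ yz yα t vz vα c →
      yz + t * vz - (yα + t * vα) * c ≡ yz - yα * c + t * (vz - vα * c)
    identity = solve-∀ ℚ-ring

  lin-affine : ∀ u y t v → lin u (y +ᵥ (t ·ᵥ v)) ≡ lin u y +ᵥ (t ·ᵥ lin u v)
  lin-affine u y t v = go (word u)
    where
    go : ∀ αs → List.foldr reflect (y +ᵥ (t ·ᵥ v)) αs ≡ List.foldr reflect y αs +ᵥ (t ·ᵥ List.foldr reflect v αs)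
    go [] = refl
    go (α ∷ αs) = trans (cong (reflect α) (go αs)) (reflect-affine α _ t _)

  ip-act : ∀ z y u → ip (act z y) u ≡ ip (translation z) u + ip (lin (dir z) y) u
  ip-act z y = ip-addˡ (translation z) (lin (dir z) y)

  act-reflAlc : ∀ H z y → act (reflAlc H z) y ≡ aref H (act z y)
  act-reflAlc H z y = ip-ext λ u → begin
    ip (act (reflAlc H z) y) u
      ≡⟨ ip-act (reflAlc H z) y u ⟩
    ip (aref H (translation z)) u + ip (reflect α (lin (dir z) y)) u
      ≡⟨ cong₂ _+_ (ip-aref H (translation z) u) (ip-reflect α (lin (dir z) y) u) ⟩
    ip (translation z) u - height H (translation z) * ip (cor α) u + (ip (lin (dir z) y) u - ip (lin (dir z) y) α * ip (cor α) u)
      ≡⟨ identity (ip (translation z) u) (ip (translation z) α) (level H) (ip (lin (dir z) y) u) (ip (lin (dir z) y) α) (ip (cor α) u) ⟩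
    ip (translation z) u + ip (lin (dir z) y) u - (ip (translation z) α + ip (lin (dir z) y) α - level H) * ip (cor α) u
      ≡⟨ cong₂ (λ r s → r - (s - level H) * ip (cor α) u) (ip-act z y u) (ip-act z y α) ⟨
    ip (act z y) u - height H (act z y) * ip (cor α) u
      ≡⟨ ip-aref H (act z y) u ⟨
    ip (aref H (act z y)) u ∎
    where
    α = root H
    identity : ∀ tu tα k lu lα c → tu - (tα - k) * c + (lu - lα * c) ≡ tu + lu - (tα + lα - k) * c
    identity = solve-∀ ℚ-ring

  -- A pointwise substitute for `InW`, which folding need not preserve literally: the root of a wall
  -- may be negative, while words in `IsW0` use positive roots.
  InReflectionGroup : Waff → Set
  InReflectionGroup z = ∀ y → y ≈W act z y

  reflAlc-inReflectionGroup : ∀ H z → IsWall H → InReflectionGroup z → InReflectionGroup (reflAlc H z)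
  reflAlc-inReflectionGroup H z isH z∈ y = z∈ y ◅◅ ((H , isH , act-reflAlc H z y) ◅ ε)

  Φ⁺⊆Φ : ∀ {α} → α ∈ Φ⁺ → α ∈ Φ
  Φ⁺⊆Φ {α} α∈Φ⁺ = proj₁ (proj₁ (proj₂ (proj₂ Φ⁺-positive) α) α∈Φ⁺)

  ≈W-reflect : ∀ {α} → α ∈ Φ → ∀ y → y ≈W reflect α y
  ≈W-reflect {α} α∈Φ y = (H[ α , 0ℚ ] , (α∈Φ , int-0) ,
    cong (λ t → y -ᵥ (t ·ᵥ cor α)) (identity (ip y α))) ◅ ε
    where
    identity : ∀ t → t ≡ t - 0ℚ
    identity = solve-∀ ℚ-ring

  ≈W-lin : ∀ u → IsW0 u → ∀ y → y ≈W lin u y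
  ≈W-lin u u∈W0 y = go (word u) u∈W0
    where
    go : ∀ αs → All (_∈ Φ⁺) αs → y ≈W List.foldr reflect y αs
    go [] [] = ε
    go (α ∷ αs) (α∈ ∷ αs∈) = go αs αs∈ ◅◅ ≈W-reflect (Φ⁺⊆Φ α∈) _

  -- Translation by k α^∨ is the product of the reflections in the walls (α, k) and (α, 0).
  ≈W-translate : ∀ {α k} → α ∈ Φ → IsInt k → ∀ y → y ≈W ((k ·ᵥ cor α) +ᵥ y)
  ≈W-translate {α} {k} α∈Φ k-int y =
    ≈W-reflect α∈Φ y ◅◅ ((H[ α , k ] , (α∈Φ , k-int) , sym translate) ◅ ε)
    where
    identity : ∀ yz yα k c → yz - yα * c - (yα - yα * 2ℚ - k) * c ≡ k * c + yz
    identity = solve-∀ ℚ-ring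
    translate : aref H[ α , k ] (reflect α y) ≡ (k ·ᵥ cor α) +ᵥ y
    translate = ip-ext λ z → begin
      ip (aref H[ α , k ] (reflect α y)) z
        ≡⟨ ip-aref H[ α , k ] (reflect α y) z ⟩
      ip (reflect α y) z - (ip (reflect α y) α - k) * ip (cor α) z
        ≡⟨ cong₂ (λ r s → r - (s - k) * ip (cor α) z) (ip-reflect α y z)
             (trans (ip-reflect α y α) (cong (λ t → ip y α - ip y α * t) (ip-cor-root (proj₂ (coroot α∈Φ))))) ⟩
      ip y z - ip y α * ip (cor α) z - (ip y α - ip y α * 2ℚ - k) * ip (cor α) z
        ≡⟨ identity (ip y z) (ip y α) k (ip (cor α) z) ⟩
      k * ip (cor α) z + ip y z
        ≡⟨ cong (_+ ip y z) (ip-scalˡ k (cor α) z) ⟨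
      ip (k ·ᵥ cor α) z + ip y z
        ≡⟨ ip-addˡ (k ·ᵥ cor α) y z ⟨
      ip ((k ·ᵥ cor α) +ᵥ y) z ∎

  +ᵥ-assoc : ∀ (x y z : V) → (x +ᵥ y) +ᵥ z ≡ x +ᵥ (y +ᵥ z)
  +ᵥ-assoc x y z = ip-ext λ u → begin
    ip ((x +ᵥ y) +ᵥ z) u           ≡⟨ ip-addˡ (x +ᵥ y) z u ⟩
    ip (x +ᵥ y) u + ip z u         ≡⟨ cong (_+ ip z u) (ip-addˡ x y u) ⟩
    ip x u + ip y u + ip z u       ≡⟨ +-assoc (ip x u) (ip y u) (ip z u) ⟩
    ip x u + (ip y u + ip z u)     ≡⟨ cong (_+_ (ip x u)) (ip-addˡ y z u) ⟨
    ip x u + ip (y +ᵥ z) u         ≡⟨ ip-addˡ x (y +ᵥ z) u ⟨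
    ip (x +ᵥ (y +ᵥ z)) u           ∎

  0ᵥ-identityˡ : ∀ (y : V) → 0ᵥ +ᵥ y ≡ y
  0ᵥ-identityˡ y = ip-ext λ u →
    trans (ip-addˡ 0ᵥ y u) (trans (cong (_+ ip y u) (ip-0ˡ u)) (+-identityˡ (ip y u)))

  ≈W-coroot-lattice : ∀ {μ} → InCorootLattice μ → ∀ y → y ≈W (μ +ᵥ y)
  ≈W-coroot-lattice (cs , cs∈Φ , refl) y = go cs cs∈Φ
    where
    sum : List (ℤ × V) → V
    sum = List.foldr (λ p acc → (fromℤ (proj₁ p) ·ᵥ cor (proj₂ p)) +ᵥ acc) 0ᵥ
    go : ∀ cs → All (λ p → proj₂ p ∈ Φ) cs → y ≈W (sum cs +ᵥ y)
    go [] [] = subst (y ≈W_) (sym (0ᵥ-identityˡ y)) ε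
    go ((k , α) ∷ cs) (α∈ ∷ cs∈) = subst (y ≈W_) (sym (+ᵥ-assoc (fromℤ k ·ᵥ cor α) (sum cs) y))
      (go cs cs∈ ◅◅ ≈W-translate α∈ (k , refl) (sum cs +ᵥ y))

  InW⇒inReflectionGroup : ∀ z → InW z → InReflectionGroup z
  InW⇒inReflectionGroup z (μ∈ , u∈) y = ≈W-lin (dir z) u∈ y ◅◅ ≈W-coroot-lattice μ∈ (lin (dir z) y)

  -- Elements of W and their alcoves

  generic⇒InCf : ∀ {x} → Generic x → InCf x
  generic⇒InCf x-generic α α∈Φ⁺ = <⇒≤ (proj₁ (x-generic α α∈Φ⁺)) , <⇒≤ (proj₂ (x-generic α α∈Φ⁺))

  -- All inequalities of the alcove are strict at `x`, which leaves room in every direction; each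
  -- positive root contributes one bound from below and one from above.
  perturb : ∀ {x} → Generic x → ∀ v → ∃[ t ] (0ℚ < t × InCf (x +ᵥ (t ·ᵥ v)))
  perturb {x} x-generic v with small-multiples
      (List.map (λ α → ip x α , - ip v α) Φ⁺ ++ List.map (λ α → 1ℚ - ip x α , ip v α) Φ⁺)
      (All.++⁺ (All.map⁺ (All.tabulate λ {α} α∈ → proj₁ (x-generic α α∈)))
               (All.map⁺ (All.tabulate λ {α} α∈ → <⇒0<- (proj₂ (x-generic α α∈)))))
  ... | t , t>0 , small with All.++⁻ (List.map (λ α → ip x α , - ip v α) Φ⁺) (small t (<⇒≤ t>0) ≤-refl)
  ...   | lower , upper = t , t>0 , λ α α∈ →
          subst (0ℚ ≤_) (trans (identity₁ (ip x α) t (ip v α)) (sym (ip-affine x t v α)))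
            (≤⇒0≤- (All.lookup (All.map⁻ lower) α∈)) ,
          subst₂ _≤_ (sym (ip-affine x t v α)) (identity₂ (ip x α))
            (+-monoʳ-≤ (ip x α) (All.lookup (All.map⁻ upper) α∈))
    where
    identity₁ : ∀ p t q → p - t * (- q) ≡ p + t * q
    identity₁ = solve-∀ ℚ-ring
    identity₂ : ∀ p → p + (1ℚ - p) ≡ 1ℚ
    identity₂ = solve-∀ ℚ-ring

  -- The point `act z y` is also `act z' y'` for some `y'` in the fundamental alcove. Then `y` and
  -- `y'` share an orbit and coincide.
  act-determined : ∀ z z' → InReflectionGroup z → InReflectionGroup z' → AlcEq z z' →
    ∀ y → InCf y → act z y ≡ act z' y
  act-determined z z' z∈ z'∈ same y y∈ with proj₁ (same (act z y)) (y , y∈ , refl)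
  ... | y' , y'∈ , zy≡z'y' = trans zy≡z'y' (cong (act z') (sym (alcove-fundamental y∈ y'∈
        (z∈ y ◅◅ subst (_≈W y') (sym zy≡z'y') (reverse ~-sym (z'∈ y'))))))

  -- The two affine maps agree at `x` and at a nearby point of the alcove in direction `v`. The
  -- difference of the images is `t` times the linear part at `v`, and `t` cancels.
  direction-determined : ∀ z z' → InReflectionGroup z → InReflectionGroup z' → AlcEq z z' → dir z ≈₀ dir z'
  direction-determined z z' z∈ z'∈ same v = ip-ext λ u → *-cancelˡ-pos t>0 (begin
    t * ip (lin (dir z) v) u                        ≡⟨ cancel (ip (act z x) u) (t * ip (lin (dir z) v) u) ⟩
    ip (act z x) u + t * ip (lin (dir z) v) u - ip (act z x) u
      ≡⟨ cong (_- ip (act z x) u) (ip-act-affine z u) ⟨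
    ip (act z (x +ᵥ (t ·ᵥ v))) u - ip (act z x) u
      ≡⟨ cong₂ (λ r s → ip r u - ip s u) (fixed _ xv∈) (fixed x (generic⇒InCf x-generic)) ⟩
    ip (act z' (x +ᵥ (t ·ᵥ v))) u - ip (act z' x) u
      ≡⟨ cong (_- ip (act z' x) u) (ip-act-affine z' u) ⟩
    ip (act z' x) u + t * ip (lin (dir z') v) u - ip (act z' x) u
      ≡⟨ cancel (ip (act z' x) u) (t * ip (lin (dir z') v) u) ⟨
    t * ip (lin (dir z') v) u                       ∎)
    where
    x = proj₁ generic-point
    x-generic = proj₂ generic-point
    perturbation = perturb x-generic v
    t = proj₁ perturbation
    t>0 = proj₁ (proj₂ perturbation)
    xv∈ = proj₂ (proj₂ perturbation)
    fixed = act-determined z z' z∈ z'∈ same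
    cancel : ∀ s r → r ≡ s + r - s
    cancel = solve-∀ ℚ-ring
    ip-act-affine : ∀ z u → ip (act z (x +ᵥ (t ·ᵥ v))) u ≡ ip (act z x) u + t * ip (lin (dir z) v) u
    ip-act-affine z u = begin
      ip (act z (x +ᵥ (t ·ᵥ v))) u
        ≡⟨ ip-act z (x +ᵥ (t ·ᵥ v)) u ⟩
      ip (translation z) u + ip (lin (dir z) (x +ᵥ (t ·ᵥ v))) u
        ≡⟨ cong (λ r → ip (translation z) u + ip r u) (lin-affine (dir z) x t v) ⟩
      ip (translation z) u + ip (lin (dir z) x +ᵥ (t ·ᵥ lin (dir z) v)) u
        ≡⟨ cong (_+_ (ip (translation z) u)) (ip-affine (lin (dir z) x) t (lin (dir z) v) u) ⟩
      ip (translation z) u + (ip (lin (dir z) x) u + t * ip (lin (dir z) v) u)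
        ≡⟨ +-assoc (ip (translation z) u) (ip (lin (dir z) x) u) (t * ip (lin (dir z) v) u) ⟨
      ip (translation z) u + ip (lin (dir z) x) u + t * ip (lin (dir z) v) u
        ≡⟨ cong (_+ t * ip (lin (dir z) v) u) (ip-act z x u) ⟨
      ip (act z x) u + t * ip (lin (dir z) v) u ∎

  -- Classes of walls

  reflect-proportional : ∀ {α β a b} → IsCoroot α a → IsCoroot β b →
    (∀ y → ip y α ≡ b * ip α β * ip y β) → ∀ y → reflect β y ≡ reflect α y
  reflect-proportional {α} {β} {a} {b} (⟨ _ , a*αα≡1 , cor-a ⟩) (⟨ _ , _ , cor-b ⟩) prop y = ip-ext λ z → begin
    ip (reflect β y) z                                       ≡⟨ ip-reflect β y z ⟩
    ip y z - ip y β * ip (cor β) z                           ≡⟨ cong (λ t → ip y z - ip y β * t) (cor-b z) ⟩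
    ip y z - ip y β * (2ℚ * b * ip β z)                      ≡⟨ identity₁ (ip y z) (ip y β) 2ℚ b (ip β z) ⟩
    -- A reflection does not depend on the scale of its root. By hypothesis `α` is `b * ip α β`
    -- times `β`, and the factor 1, rewritten by `ratio`, turns both occurrences of `β` into `α`.
    ip y z - ip y β * (2ℚ * b * ip β z) * 1ℚ                 ≡⟨ cong (λ t → ip y z - ip y β * (2ℚ * b * ip β z) * t) ratio ⟨
    ip y z - ip y β * (2ℚ * b * ip β z) * (a * (b * ip α β * ip α β))
      ≡⟨ identity₂ (ip y z) (ip y β) 2ℚ a b (ip β z) (ip α β) ⟩
    ip y z - (b * ip α β * ip y β) * (2ℚ * a * (b * ip α β * ip β z))
      ≡⟨ cong₂ (λ r s → ip y z - r * (2ℚ * a * s)) (prop y) (trans (ip-sym α z) (trans (prop z) (cong (b * ip α β *_) (ip-sym z β)))) ⟨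
    ip y z - ip y α * (2ℚ * a * ip α z)                      ≡⟨ cong (λ t → ip y z - ip y α * t) (cor-a z) ⟨
    ip y z - ip y α * ip (cor α) z                           ≡⟨ ip-reflect α y z ⟨
    ip (reflect α y) z                                       ∎
    where
    ratio : a * (b * ip α β * ip α β) ≡ 1ℚ
    ratio = trans (cong (a *_) (sym (prop α))) a*αα≡1
    identity₁ : ∀ t yβ c b βz → t - yβ * (c * b * βz) ≡ t - yβ * (c * b * βz) * 1ℚ
    identity₁ = solve-∀ ℚ-ring
    identity₂ : ∀ t yβ c a b βz g →
      t - yβ * (c * b * βz) * (a * (b * g * g)) ≡ t - (b * g * yβ) * (c * a * (b * g * βz))
    identity₂ = solve-∀ ℚ-ring

  -- Both (level H · b) β and the projection of y along β lie on H, hence have the same pairing with α.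
  class-proportional : ∀ {b} H {α} → IsCoroot (root H) b → HasClass H α →
    ∀ y → ip y α ≡ b * ip α (root H) * ip y (root H)
  class-proportional {b} H {α} (⟨ _ , b*ββ≡1 , _ ⟩) (k , _ , _ , same) y = begin
    ip y α                                           ≡⟨ split (ip y α) s t (ip β α) ⟩
    ip y α + (s - t) * ip β α - s * ip β α + t * ip β α
      ≡⟨ cong₂ (λ p q → p - q + t * ip β α) (ip-affine y (s - t) β α) (ip-scalˡ s β α) ⟨
    ip (y +ᵥ ((s - t) ·ᵥ β)) α - ip (s ·ᵥ β) α + t * ip β α
      ≡⟨ cong₂ (λ p q → p - q + t * ip β α) (proj₁ (same _) on-wall₁) (proj₁ (same _) on-wall₀) ⟩
    k - k + t * ip β α                               ≡⟨ finish k (ip y β) b (ip β α) ⟩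
    b * ip β α * ip y β                              ≡⟨ cong (λ t → b * t * ip y β) (ip-sym β α) ⟩
    b * ip α β * ip y β                              ∎
    where
    β = root H
    l = level H
    s = l * b
    t = ip y β * b
    split : ∀ p s t g → p ≡ p + (s - t) * g - s * g + t * g
    split = solve-∀ ℚ-ring
    finish : ∀ k yβ b g → k - k + yβ * b * g ≡ b * g * yβ
    finish = solve-∀ ℚ-ring
    on-wall₀ : OnWall H (s ·ᵥ β)
    on-wall₀ = trans (ip-scalˡ s β β) (trans (*-assoc l b (ip β β)) (trans (cong (l *_) b*ββ≡1) (*-identityʳ l)))
    on-wall₁ : OnWall H (y +ᵥ ((s - t) ·ᵥ β))
    on-wall₁ = begin
      ip (y +ᵥ ((s - t) ·ᵥ β)) β                ≡⟨ ip-affine y (s - t) β β ⟩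
      ip y β + (s - t) * ip β β                 ≡⟨ regroup (ip y β) l b (ip β β) ⟩
      ip y β + (l - ip y β) * (b * ip β β)      ≡⟨ cong (λ r → ip y β + (l - ip y β) * r) b*ββ≡1 ⟩
      ip y β + (l - ip y β) * 1ℚ                ≡⟨ collapse (ip y β) l ⟩
      l                                         ∎
      where
      regroup : ∀ yβ l b n → yβ + (l * b - yβ * b) * n ≡ yβ + (l - yβ) * (b * n)
      regroup = solve-∀ ℚ-ring
      collapse : ∀ yβ l → yβ + (l - yβ) * 1ℚ ≡ l
      collapse = solve-∀ ℚ-ring

  -- Folding reflects in the stored root of a wall, the moment graph in its class, and a class only
  -- records that two hyperplanes coincide. This reconciles the two.
  reflect-class : ∀ H {α} → IsWall H → HasClass H α → ∀ y → reflect (root H) y ≡ reflect α y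
  reflect-class H (β∈Φ , _) class@(_ , α∈Φ⁺ , _) =
    reflect-proportional (proj₂ (coroot (Φ⁺⊆Φ α∈Φ⁺))) is (class-proportional H is class)
    where
    is = proj₂ (coroot β∈Φ)

  -- Folded galleries

  Walls : Gallery → Set
  Walls γ = All (IsWall ∘ wall) (steps γ)

  ValidSteps⇒Walls : ∀ {c} ss → ValidSteps c ss → All (IsWall ∘ wall) ss
  ValidSteps⇒Walls [] _ = []
  ValidSteps⇒Walls (s ∷ ss) (isH , _ , _ , _ , valid) = isH ∷ ValidSteps⇒Walls ss valid

  last : Waff → List Step → Waff
  last = List.foldl λ _ s → alc s

  ValidSteps⇒last∈W : ∀ {c} ss → InW c → ValidSteps c ss → InW (last c ss)
  ValidSteps⇒last∈W [] c∈W _ = c∈W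
  ValidSteps⇒last∈W (s ∷ ss) _ (_ , c∈W , _ , _ , valid) = ValidSteps⇒last∈W ss c∈W valid

  last-reflected : ∀ H c ss → last (reflAlc H c) (List.map (reflStep H) ss) ≡ reflAlc H (last c ss)
  last-reflected H c [] = refl
  last-reflected H c (s ∷ ss) = last-reflected H (alc s) ss

  last-foldSteps : ∀ i c ss {s} → nth ss i ≡ just s → last c (foldSteps i ss) ≡ reflAlc (wall s) (last c ss)
  last-foldSteps zero c (s ∷ ss) refl = last-reflected (wall s) (alc s) ss
  last-foldSteps (suc i) c (s ∷ ss) at = last-foldSteps i (alc s) ss at

  nth-foldSteps : ∀ i ss {s} → nth ss i ≡ just s → nth (foldSteps i ss) i ≡ just (step (wall s) (reflAlc (wall s) (alc s)))
  nth-foldSteps zero (s ∷ ss) refl = refl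
  nth-foldSteps (suc i) (s ∷ ss) at = nth-foldSteps i ss at

  nth-foldSteps-before : ∀ {i j} ss → i <ℕ j → nth (foldSteps j ss) i ≡ nth ss i
  nth-foldSteps-before [] _ = refl
  nth-foldSteps-before {zero} {suc j} (s ∷ ss) _ = refl
  nth-foldSteps-before {suc i} {suc j} (s ∷ ss) (ℕ.s≤s i<j) = nth-foldSteps-before ss i<j

  -- Classes are read off in the final gallery, whereas each fold reflects in a wall of an
  -- intermediate one. As the indices increase, the two walls agree.
  nth-foldAll-before : ∀ {i} is γ → All (i <ℕ_) is → nth (steps (foldAll is γ)) i ≡ nth (steps γ) i
  nth-foldAll-before [] γ [] = refl
  nth-foldAll-before (j ∷ is) γ (i<j ∷ i<is) =
    trans (nth-foldAll-before is (foldAt j γ) i<is) (nth-foldSteps-before (steps γ) i<j)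

  nth-defined : ∀ {i} (ss : List Step) → i <ℕ length ss → ∃[ s ] (nth ss i ≡ just s)
  nth-defined {zero} (s ∷ ss) _ = s , refl
  nth-defined {suc i} (s ∷ ss) (ℕ.s≤s i<) = nth-defined ss i<

  nth-All : ∀ {P : Step → Set} {ss i s} → All P ss → nth ss i ≡ just s → P s
  nth-All {i = zero} (p ∷ _) refl = p
  nth-All {i = suc i} (_ ∷ ps) at = nth-All ps at

  length-foldSteps : ∀ i ss → length (foldSteps i ss) ≡ length ss
  length-foldSteps i [] = refl
  length-foldSteps zero (s ∷ ss) = cong suc (length-map (reflStep (wall s)) ss)
  length-foldSteps (suc i) (s ∷ ss) = cong suc (length-foldSteps i ss)

  foldSteps-walls : ∀ i {ss} → All (IsWall ∘ wall) ss → All (IsWall ∘ wall) (foldSteps i ss)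
  foldSteps-walls i [] = []
  foldSteps-walls zero {s ∷ _} (isH ∷ isHs) =
    isH ∷ All.map⁺ (All.map (λ {s'} → isWall-reflWall (wall s) (wall s') isH) isHs)
  foldSteps-walls (suc i) (isH ∷ isHs) = isH ∷ foldSteps-walls i isHs

  pathEnd-cong : ∀ {u u'} αs → u ≈₀ u' → pathEnd u αs ≈₀ pathEnd u' αs
  pathEnd-cong [] u≈u' = u≈u'
  pathEnd-cong (α ∷ αs) u≈u' = pathEnd-cong αs λ y → cong (reflect α) (u≈u' y)

  -- The first fold multiplies the direction of the end alcove by one reflection, which is the first
  -- edge of the path; the remaining folds start from there. The invariants `Walls` and
  -- `InReflectionGroup` survive each fold.
  foldAll-end : ∀ is γ pat → AllPairs _<ℕ_ is → All (_<ℕ length (steps γ)) is → Walls γ →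
    Pointwise (HasClassAt (foldAll is γ)) is pat → InReflectionGroup (endAlc γ) →
    InReflectionGroup (endAlc (foldAll is γ)) × dir (endAlc (foldAll is γ)) ≈₀ pathEnd (dir (endAlc γ)) pat
  foldAll-end [] γ [] [] [] walls [] end∈ = end∈ , λ _ → refl
  foldAll-end (i ∷ is) γ (α ∷ pat) (i<is ∷ sorted) (i< ∷ is<) walls ((s' , at' , class) ∷ classes) end∈
    with nth-defined (steps γ) i<
  ... | s , at = proj₁ rec , λ y → trans (proj₂ rec y) (pathEnd-cong pat first y)
    where
    H = wall s
    isH = nth-All walls at
    end≡ : endAlc (foldAt i γ) ≡ reflAlc H (endAlc γ)
    end≡ = last-foldSteps i (start γ) (steps γ) at
    same-wall : wall s' ≡ H
    same-wall = cong wall (just-injective (trans (sym at')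
      (trans (nth-foldAll-before is (foldAt i γ) i<is) (nth-foldSteps i (steps γ) at))))
    first : dir (endAlc (foldAt i γ)) ≈₀ rW0 α (dir (endAlc γ))
    first y = trans (cong (λ z → lin (dir z) y) end≡)
      (reflect-class H isH (subst (λ H → HasClass H α) same-wall class) (lin (dir (endAlc γ)) y))
    rec = foldAll-end is (foldAt i γ) pat sorted
      (subst (λ n → All (_<ℕ n) is) (sym (length-foldSteps i (steps γ))) is<)
      (foldSteps-walls i walls) classes
      (subst InReflectionGroup (sym end≡) (reflAlc-inReflectionGroup H (endAlc γ) isH end∈))

theorem4p16 : (R : RootSystem) → let open RS R in
    (w : W0) → IsW0 w →
    (λ₀ : V) → InCorootLattice λ₀ → (v : W0) → IsW0 v →
    (γ : Gallery) → IsGallery γ →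
    AlcEq (start γ) idW → AlcEq (endAlc γ) (t^ λ₀ · v) →
    (pat : List V) → All (_∈ Φ⁺) pat → CanApply w γ pat →
    (γ' : Gallery) → ObtainedByFolding γ pat γ' →
    (z : Waff) → InW z → AlcEq (endAlc γ') z →
    ζ z ≈₀ pathEnd v pat
theorem4p16 R w _ λ₀ λ₀∈ v v∈ γ (start∈ , valid) _ end≈ pat _ _ .(RS.foldAll R is γ)
  (is , linked , is< , refl , classes) z z∈ end'≈ y = begin
  lin (dir z) y
    -- End alcoves are given only as sets, for `γ'` as for `γ`, so at both ends of the chain the
    -- direction is recovered from the set.
    ≡⟨ direction-determined (endAlc (foldAll is γ)) z (proj₁ folded) (InW⇒inReflectionGroup z z∈) end'≈ y ⟨
  lin (dir (endAlc (foldAll is γ))) y         ≡⟨ proj₂ folded y ⟩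
  lin (pathEnd (dir (endAlc γ)) pat) y
    ≡⟨ pathEnd-cong pat (direction-determined (endAlc γ) (t^ λ₀ · v) end∈ (InW⇒inReflectionGroup _ (λ₀∈ , v∈)) end≈) y ⟩
  lin (pathEnd v pat) y                       ∎
  where
  open RS R renaming (refl to reflect; trans to translation)
  open Geometry R
  open ≡-Reasoning
  end∈ : InReflectionGroup (endAlc γ)
  end∈ = InW⇒inReflectionGroup (endAlc γ) (ValidSteps⇒last∈W (steps γ) start∈ valid)
  folded = foldAll-end is γ pat (Linked⇒AllPairs ℕ.<-trans linked) is< (ValidSteps⇒Walls (steps γ) valid) classes end∈
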